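{- Let $\mathbb{K}$ be a subfield of $\overline{\mathbb{Q}}$. For any $k\leq d$, the problems $\mathrm{Orbit}_{\mathbb{K}}(d,d-k)$ and $\mathrm{SimSkolem}_{\mathbb{K}}(d,k)$ are equivalent, i.e. each is effectively reducible to the other.
   Context: $\overline{\mathbb{Q}}$ denotes the field of algebraic numbers; numbers in inputs are given in any standard effective representation. (The cases of interest are $\mathbb{K}=\mathbb{Q}$ and $\mathbb{K}=\overline{\mathbb{Q}}$.) Linear dynamical systems. An LDS is a pair $(A,\boldsymbol{x}) \in \mathbb{K}^{d\times d}\times \mathbb{K}^d$. It is non-degenerate if no ratio of distinct eigenvalues of $A$ is a root of unity. It is reduced if it is non-degenerate and $\dim \mathrm{span}\{A^n\boldsymbol{x} : n\ge m\} = d$ for all $m \geq 0$. $\mathrm{Orbit}_{\mathbb{K}}(d,t)$: given a reduced LDS $(A,\boldsymbol{x}) \in \mathbb{K}^{d\times d}\times \mathbb{K}^d$ and a linear subspace $S\subseteq \mathbb{K}^d$ of dimension $t$, decide whether there is $n \in \mathbb{N}$ with $A^n\boldsymbol{x}\in S$. Linear recurrence sequences. A linear recurrence relation of order $d$ over $\mathbb{K}$ is $u_n = c_1u_{n-1}+\dots+c_du_{n-d}$ with $c_i \in \mathbb{K}$, $c_d\neq 0$; its characteristic polynomial is $x^d - c_1x^{d-1}-\dots-c_d$. A $\mathbb{K}$-LRS is a sequence $\langle u_n\rangle_{n\in\mathbb{N}}$ in $\mathbb{K}$ satisfying such a relation; it is non-degenerate if no ratio of distinct roots of the characteristic polynomial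 is a root of unity. LRS $u^{(1)},\dots,u^{(k)}$ are linearly independent if no non-trivial $\overline{\mathbb{Q}}$-linear combination of them is the zero sequence. $\mathrm{SimSkolem}_{\mathbb{K}}(d,k)$: given $k$ linearly independent non-degenerate $\mathbb{K}$-LRS $u^{(1)},\dots,u^{(k)}$ that satisfy the same recurrence relation of order $d$, decide whether there is $n\in\mathbb{N}$ with $u^{(1)}_n=\dots=u^{(k)}_n=0$. -}

module Defs where

open import Algebra.Bundles using (CommutativeRing; RawRing)
open import Algebra.Morphism.Structures using (IsRingMonomorphism)
import Algebra.Definitions.RawSemiring as RawSemiringDefinitions
import Algebra.Morphism.RingMonomorphism as RingMonomorphism
import Algebra.Properties.Semiring.Sum as SemiringSum
open import Data.Fin.Base using (Fin; zero; suc; toℕ; fromℕ; inject₁; opposite)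
open import Data.Fin.Properties
  using (toℕ-fromℕ; toℕ-inject₁; toℕ<n; opposite-prop)
open import Data.Integer.Base using (ℤ; +_; -[1+_])
open import Data.Nat.Base as ℕ using (ℕ; zero; suc; _∸_; _≤_)
import Data.Nat.Properties as ℕₚ
open import Data.Product.Base using (Σ; ∃-syntax; _×_; _,_; proj₁)
open import Data.Vec.Functional using (Vector; head; tail; map; insertAt)
open import Function.Base using (_∘_)
open import Function.Bundles using (_⇔_)
open import Level using (Level; _⊔_) renaming (suc to lsuc)
open import Relation.Binary.Definitions using (Decidable)
open import Relation.Binary.PropositionalEquality
  using (_≡_; cong; subst)
import Relation.Binary.PropositionalEquality as ≡
open import Relation.Nullary.Negation using (¬_)

private
  variable
    d k r t : ℕ

record DiscreteField c ℓ : Set (lsuc (c ⊔ ℓ)) where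
  infix  4 _≟_
  infix  8 _⁻¹
  infixl 7 _/_
  field
    commutativeRing : CommutativeRing c ℓ

  open CommutativeRing commutativeRing public

  field
    _≟_        : Decidable _≈_
    1≉0        : ¬ (1# ≈ 0#)
    -- Total for convenience; the value of 0# ⁻¹ is unspecified.
    _⁻¹        : Carrier → Carrier
    ⁻¹-inverse : ∀ x → ¬ (x ≈ 0#) → x * x ⁻¹ ≈ 1#

  _/_ : Carrier → Carrier → Carrier
  x / y = x * y ⁻¹

module Evaluation {c ℓ} (R : CommutativeRing c ℓ) where
  open CommutativeRing R hiding (zero)
  open RawSemiringDefinitions (RawRing.rawSemiring rawRing) public using (sum; _^_)
    renaming (_×_ to _·_)

  fromℤ : ℤ → Carrier
  fromℤ (+ n)    = n · 1#
  fromℤ -[1+ n ] = - (suc n · 1#)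

  -- The coefficient of zⁱ is p i.
  eval : Vector Carrier r → Carrier → Carrier
  eval p z = sum (λ i → p i * z ^ toℕ i)

-- The field of algebraic numbers is determined up to isomorphism as an
-- algebraically closed field of characteristic 0 all of whose elements are
-- algebraic over ℚ.  Any such field with decidable equality serves as an
-- effective representation of it.
record AlgebraicNumbers c ℓ : Set (lsuc (c ⊔ ℓ)) where
  field
    discreteField : DiscreteField c ℓ

  open DiscreteField discreteField public
  open Evaluation commutativeRing public

  field
    characteristic-0     : ∀ n → ¬ (suc n · 1# ≈ 0#)
    algebraically-closed : ∀ {n} (p : Vector Carrier (suc n)) →
                           ∃[ z ] z ^ suc n + eval p z ≈ 0#
    algebraic            : ∀ z → ∃[ n ] Σ (Vector ℤ n) λ p →
                           (∃[ i ] ¬ (p i ≡ + 0)) ×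
                           eval (map fromℤ p) z ≈ 0#

record Subfield {c ℓ} (F : DiscreteField c ℓ) p : Set (c ⊔ ℓ ⊔ lsuc p) where
  open DiscreteField F
  field
    _∈K       : Carrier → Set p
    ∈K-resp-≈ : ∀ {x y} → x ≈ y → x ∈K → y ∈K
    0∈K       : 0# ∈K
    1∈K       : 1# ∈K
    +-closed  : ∀ {x y} → x ∈K → y ∈K → (x + y) ∈K
    *-closed  : ∀ {x y} → x ∈K → y ∈K → (x * y) ∈K
    -‿closed  : ∀ {x} → x ∈K → (- x) ∈K
    ⁻¹-closed : ∀ {x} → ¬ (x ≈ 0#) → x ∈K → (x ⁻¹) ∈K

  K : Set (c ⊔ p)
  K = Σ Carrier _∈K

  ι : K → Carrier
  ι = proj₁

  K-rawRing : RawRing (c ⊔ p) ℓ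
  K-rawRing = record
    { Carrier = K
    ; _≈_     = λ x y → ι x ≈ ι y
    ; _+_     = λ (x , x∈K) (y , y∈K) → x + y , +-closed x∈K y∈K
    ; _*_     = λ (x , x∈K) (y , y∈K) → x * y , *-closed x∈K y∈K
    ; -_      = λ (x , x∈K) → - x , -‿closed x∈K
    ; 0#      = 0# , 0∈K
    ; 1#      = 1# , 1∈K
    }

  ι-isRingMonomorphism : IsRingMonomorphism K-rawRing rawRing ι
  ι-isRingMonomorphism = record
    { isRingHomomorphism = record
      { isSemiringHomomorphism = record
        { isNearSemiringHomomorphism = record
          { +-isMonoidHomomorphism = record
            { isMagmaHomomorphism = record
              { isRelHomomorphism = record { cong = λ x≈y → x≈y }
              ; homo              = λ _ _ → refl
              }
            ; ε-homo = refl
            }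
          ; *-homo = λ _ _ → refl
          }
        ; 1#-homo = refl
        }
      ; -‿homo = λ _ → refl
      }
    ; injective = λ x≈y → x≈y
    }

  K-commutativeRing : CommutativeRing (c ⊔ p) ℓ
  K-commutativeRing = record
    { RawRing K-rawRing
    ; isCommutativeRing =
        RingMonomorphism.isCommutativeRing ι-isRingMonomorphism isCommutativeRing
    }

module LinearAlgebra {c ℓ} (R : CommutativeRing c ℓ) where
  open CommutativeRing R hiding (zero)
  open RawSemiringDefinitions (RawRing.rawSemiring rawRing) using (sum)

  infix  4 _≋_
  infixr 7 _*ᵥ_

  _≋_ : Vector Carrier d → Vector Carrier d → Set ℓ
  v ≋ w = ∀ i → v i ≈ w i

  0ᵥ : Vector Carrier d
  0ᵥ _ = 0#

  Matrix : ℕ → Set c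
  Matrix d = Vector (Vector Carrier d) d

  _*ᵥ_ : Matrix d → Vector Carrier d → Vector Carrier d
  (A *ᵥ v) i = sum (λ j → A i j * v j)

  -- orbit A x n is Aⁿx.
  orbit : Matrix d → Vector Carrier d → ℕ → Vector Carrier d
  orbit A x zero    = x
  orbit A x (suc n) = A *ᵥ orbit A x n

  combination : Vector Carrier r → Vector (Vector Carrier d) r → Vector Carrier d
  combination a v i = sum (λ j → a j * v j i)

  LinearlyIndependent : Vector (Vector Carrier d) r → Set (c ⊔ ℓ)
  LinearlyIndependent v = ∀ a → combination a v ≋ 0ᵥ → ∀ j → a j ≈ 0#

  -- The linear span of a family with an arbitrary index set: all finite linear
  -- combinations of its members.
  Span : {I : Set} → (I → Vector Carrier d) → Vector Carrier d → Set (c ⊔ ℓ)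
  Span {I = I} g v =
    ∃[ r ] Σ (Vector Carrier r) λ a → Σ (Vector I r) λ s → v ≋ combination a (g ∘ s)

  HasDimension : (Vector Carrier d → Set (c ⊔ ℓ)) → ℕ → Set (c ⊔ ℓ)
  HasDimension V t = Σ (Vector (Vector Carrier _) t) λ b →
    LinearlyIndependent b × (∀ v → V v ⇔ Span b v)

module Recurrence {c ℓ} (R : CommutativeRing c ℓ) where
  open CommutativeRing R hiding (zero)
  open SemiringSum semiring using (sum; sum-cong-≋)

  -- The coefficient c_{i+1} of the recurrence is c i.
  Satisfies : Vector Carrier d → (ℕ → Carrier) → Set ℓ
  Satisfies {d} c u = ∀ n → d ≤ n → u n ≈ sum (λ i → c i * u (n ∸ suc (toℕ i)))

  next : Vector Carrier d → Vector Carrier d → Carrier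
  next c w = sum (λ i → c i * w (opposite i))

  extend : Vector Carrier d → Vector Carrier d → Vector Carrier (suc d)
  extend {d} c w = insertAt w (fromℕ d) (next c w)

  -- window c a n is (u_n, …, u_{n+d-1}).
  window : Vector Carrier d → Vector Carrier d → ℕ → Vector Carrier d
  window c a zero    = a
  window c a (suc n) = tail (extend c (window c a n))

  -- The sequence with recurrence coefficients c and initial values a.  Taking
  -- the head after extending the window also covers d = 0.  By lrs-satisfies
  -- and lrs-unique these are exactly the sequences satisfying the recurrence.
  lrs : Vector Carrier d → Vector Carrier d → ℕ → Carrier
  lrs c a n = head (extend c (window c a n))

  private
    insertAt-inject₁ : (w : Vector Carrier d) (x : Carrier) (i : Fin d) →
                       insertAt w (fromℕ d) x (inject₁ i) ≡ w i
    insertAt-inject₁ {suc d} w x zero    = ≡.refl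
    insertAt-inject₁ {suc d} w x (suc i) = insertAt-inject₁ (tail w) x i

    insertAt-fromℕ : (w : Vector Carrier d) (x : Carrier) →
                     insertAt w (fromℕ d) x (fromℕ d) ≡ x
    insertAt-fromℕ {zero}  w x = ≡.refl
    insertAt-fromℕ {suc d} w x = insertAt-fromℕ (tail w) x

    ∸-opposite : ∀ n (i : Fin d) → n ℕ.+ d ∸ suc (toℕ i) ≡ n ℕ.+ toℕ (opposite i)
    ∸-opposite {d} n i = ≡.trans (ℕₚ.+-∸-assoc n (toℕ<n i))
                                 (cong (n ℕ.+_) (≡.sym (opposite-prop i)))

    Fin-last : (P : Fin (suc d) → Set ℓ) → (∀ i → P (inject₁ i)) → P (fromℕ d) →
               ∀ j → P j
    Fin-last {zero}  P f x zero    = x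
    Fin-last {suc d} P f x zero    = f zero
    Fin-last {suc d} P f x (suc j) = Fin-last (P ∘ suc) (f ∘ suc) x j

  module _ (c a : Vector Carrier d) where

    lrs-extend : ∀ n (j : ℕ) (i : Fin (suc d)) → toℕ i ≡ j →
                 lrs c a (n ℕ.+ j) ≡ extend c (window c a n) i
    lrs-extend n zero    zero    _  rewrite ℕₚ.+-identityʳ n = ≡.refl
    lrs-extend n (suc j) (suc i) eq rewrite ℕₚ.+-suc n j =
      ≡.trans (lrs-extend (suc n) j (inject₁ i)
                 (≡.trans (toℕ-inject₁ i) (ℕₚ.suc-injective eq)))
              (insertAt-inject₁ (window c a (suc n)) _ i)

    lrs-window : ∀ n (i : Fin d) → lrs c a (n ℕ.+ toℕ i) ≡ window c a n i
    lrs-window n i =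
      ≡.trans (lrs-extend n (toℕ i) (inject₁ i) (toℕ-inject₁ i))
              (insertAt-inject₁ (window c a n) _ i)

    lrs-initial : ∀ i → lrs c a (toℕ i) ≡ a i
    lrs-initial = lrs-window 0

    lrs-satisfies : Satisfies c (lrs c a)
    lrs-satisfies n d≤n =
      subst (λ m → lrs c a m ≈ sum (λ i → c i * lrs c a (m ∸ suc (toℕ i))))
            (ℕₚ.m∸n+n≡m d≤n) (shifted (n ∸ d))
      where
      shifted : ∀ n → lrs c a (n ℕ.+ d) ≈
                      sum (λ i → c i * lrs c a (n ℕ.+ d ∸ suc (toℕ i)))
      shifted n = trans
        (reflexive (≡.trans (lrs-extend n d (fromℕ d) (toℕ-fromℕ d))
                            (insertAt-fromℕ (window c a n) _)))
        (sum-cong-≋ λ i → *-congˡ (reflexive (≡.sym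
          (≡.trans (cong (lrs c a) (∸-opposite n i)) (lrs-window n (opposite i))))))

    lrs-unique : ∀ u → Satisfies c u → (∀ i → u (toℕ i) ≈ a i) →
                 ∀ n → u n ≈ lrs c a n
    lrs-unique u sat initial n =
      trans (reflexive (cong u (≡.sym (ℕₚ.+-identityʳ n))))
            (extended n (windowed n) zero)
      where
      extended : ∀ n → (∀ i → u (n ℕ.+ toℕ i) ≈ window c a n i) →
                 ∀ j → u (n ℕ.+ toℕ j) ≈ extend c (window c a n) j
      extended n hyp = Fin-last _
        (λ i → trans (reflexive (cong (λ m → u (n ℕ.+ m)) (toℕ-inject₁ i)))
                     (trans (hyp i)
                       (reflexive (≡.sym (insertAt-inject₁ (window c a n) _ i)))))
        (trans (reflexive (cong (λ m → u (n ℕ.+ m)) (toℕ-fromℕ d)))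
          (trans (sat (n ℕ.+ d) (ℕₚ.m≤n+m d n))
            (trans (sum-cong-≋ λ i → *-congˡ
                      (trans (reflexive (cong u (∸-opposite n i)))
                             (hyp (opposite i))))
                   (reflexive (≡.sym (insertAt-fromℕ (window c a n) _))))))

      windowed : ∀ n i → u (n ℕ.+ toℕ i) ≈ window c a n i
      windowed zero    i = initial i
      windowed (suc n) i =
        trans (reflexive (cong u (≡.sym (ℕₚ.+-suc n (toℕ i)))))
              (extended n (windowed n) (suc i))

-- A decision problem whose inputs satisfy a promise, kept apart from the input.
record Problem a b e : Set (lsuc (a ⊔ b ⊔ e)) where
  field
    Input   : Set a
    Promise : Input → Set b
    Yes     : Input → Set e

-- Many-one reduction.  A function definable here without axioms is an
-- algorithm relative to the operations of the given fields, so effectiveness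
-- needs no separate clause.  The reduction sees only the input, not the
-- evidence for the promise.
infix 4 _≤ₘ_

record _≤ₘ_ {a b e a′ b′ e′} (P : Problem a b e) (Q : Problem a′ b′ e′) :
                   Set (a ⊔ b ⊔ e ⊔ a′ ⊔ b′ ⊔ e′) where
  private
    module P = Problem P
    module Q = Problem Q
  field
    reduce    : P.Input → Q.Input
    preserves : ∀ x → P.Promise x → Q.Promise (reduce x)
    correct   : ∀ x → P.Promise x → P.Yes x ⇔ Q.Yes (reduce x)

module Problems {c ℓ p} (ℚ̄ : AlgebraicNumbers c ℓ)
                (𝕂 : Subfield (AlgebraicNumbers.discreteField ℚ̄) p) where
  open AlgebraicNumbers ℚ̄
  open Subfield 𝕂 using (K; ι; K-commutativeRing)
  module Kᵐ = LinearAlgebra K-commutativeRing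
  module ℚ̄ᵐ = LinearAlgebra commutativeRing
  open Recurrence K-commutativeRing using (lrs)

  IsRootOfUnity : Carrier → Set ℓ
  IsRootOfUnity z = ∃[ n ] 1 ≤ n × z ^ n ≈ 1#

  NoRatioIsRootOfUnity : ∀ {q} → (Carrier → Set q) → Set (c ⊔ ℓ ⊔ q)
  NoRatioIsRootOfUnity P = ∀ z w → P z → P w → ¬ (z ≈ w) → ¬ (w ≈ 0#) →
                           ¬ IsRootOfUnity (z / w)

  IsEigenvalue : Kᵐ.Matrix d → Carrier → Set (c ⊔ ℓ)
  IsEigenvalue A z = ∃[ v ] ¬ (v ℚ̄ᵐ.≋ ℚ̄ᵐ.0ᵥ) ×
                     (map (map ι) A ℚ̄ᵐ.*ᵥ v) ℚ̄ᵐ.≋ map (z *_) v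

  Reduced : Kᵐ.Matrix d → Vector K d → Set (c ⊔ ℓ ⊔ p)
  Reduced {d} A x =
    NoRatioIsRootOfUnity (IsEigenvalue A) ×
    (∀ m → Kᵐ.HasDimension
             (Kᵐ.Span {I = ∃[ n ] m ≤ n} (λ (n , _) → Kᵐ.orbit A x n)) d)

  record OrbitInput (d t : ℕ) : Set (c ⊔ p) where
    field
      A     : Kᵐ.Matrix d
      x     : Vector K d
      -- A basis of the subspace S.
      basis : Vector (Vector K d) t

    S : Vector K d → Set (c ⊔ ℓ ⊔ p)
    S = Kᵐ.Span basis

  Orbit : (d t : ℕ) → Problem (c ⊔ p) (c ⊔ ℓ ⊔ p) (c ⊔ ℓ ⊔ p)
  Orbit d t = record
    { Input   = OrbitInput d t
    ; Promise = λ I → let open OrbitInput I in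
                Reduced A x × Kᵐ.LinearlyIndependent basis
    ; Yes     = λ I → let open OrbitInput I in
                ∃[ n ] S (Kᵐ.orbit A x n)
    }

  IsCharacteristicRoot : Vector K d → Carrier → Set ℓ
  IsCharacteristicRoot {d} c z =
    z ^ d - sum (λ i → ι (c i) * z ^ (d ∸ suc (toℕ i))) ≈ 0#

  -- Independence over ℚ̄, not merely over K.
  LinearlyIndependentSequences : Vector (ℕ → K) k → Set (c ⊔ ℓ)
  LinearlyIndependentSequences {k} u =
    ∀ (a : Vector Carrier k) → (∀ n → sum (λ j → a j * ι (u j n)) ≈ 0#) → ∀ j → a j ≈ 0#

  record SimSkolemInput (d k : ℕ) : Set (c ⊔ p) where
    field
      coefficients : Vector K d
      initial      : Vector (Vector K d) k

    u : Vector (ℕ → K) k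
    u j = lrs coefficients (initial j)

  -- The condition c_d ≠ 0 is vacuous for d = 0.
  SimSkolem : (d k : ℕ) → Problem (c ⊔ p) (c ⊔ ℓ) ℓ
  SimSkolem d k = record
    { Input   = SimSkolemInput d k
    ; Promise = λ I → let open SimSkolemInput I in
                (∀ i → suc (toℕ i) ≡ d → ¬ (ι (coefficients i) ≈ 0#)) ×
                NoRatioIsRootOfUnity (IsCharacteristicRoot coefficients) ×
                LinearlyIndependentSequences u
    ; Yes     = λ I → let open SimSkolemInput I in
                ∃[ n ] (∀ j → ι (u j n) ≈ 0#)
    }

-- From Orbit to SimSkolem: the functionals ξⱼ cutting out S give the sequences
-- ξⱼ(Aⁿx).  For a reduced system x, Ax, …, Aᵈ⁻¹x form a basis, so Aᵈx is a
-- combination of them, and its coefficients are the recurrence shared by all the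
-- sequences.  From SimSkolem to Orbit: A is the companion matrix of the recurrence
-- and S the common kernel of the functionals given by the initial values.  Both
-- directions rest on one elimination that computes the orthogonal complement of a
-- family of vectors.  It runs over K; its results are transferred to the field of
-- algebraic numbers, where the eigenvalues and the independence of sequences live.
module Submission where

open import Defs
open import Algebra.Bundles using (CommutativeRing; RawRing)
import Algebra.Definitions.RawSemiring as RawSemiringDefinitions
import Algebra.Properties.Group as GroupProperties
import Algebra.Properties.Ring as RingProperties
import Algebra.Properties.Semiring.Sum as SemiringSum
import Algebra.Solver.Ring.NaturalCoefficients.Default as SemiringSolver
open import Data.Bool.Base using (if_then_else_)
open import Data.Fin.Base
  using (Fin; zero; suc; toℕ; fromℕ; inject₁; opposite; punchIn)
open import Data.Fin.Properties
  using (any?; toℕ-fromℕ; toℕ-inject₁; toℕ<n; opposite-prop; opposite-involutive)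
open import Data.Fin.Permutation using (reverse)
open import Data.Fin.Relation.Unary.Top using (View; view; ‵fromℕ; ‵inject₁)
open import Data.Nat.Base as ℕ using (ℕ; zero; suc; _∸_; _≤_; _<_)
import Data.Nat.Properties as ℕₚ
open import Data.Product.Base using (Σ; ∃-syntax; _×_; _,_; proj₁; proj₂)
open import Data.Vec.Functional
  using (Vector; _∷_; head; tail; map; init; last; removeAt)
open import Function.Base using (_∘_; id)
open import Function.Bundles using (_⇔_; mk⇔; Equivalence)
open import Level using (Level; _⊔_)
open import Relation.Binary.PropositionalEquality using (_≡_; cong; subst)
import Relation.Binary.PropositionalEquality as ≡
import Relation.Binary.Reasoning.Setoid as SetoidReasoning
open import Relation.Nullary using (¬_; ¬?; yes; no; does; contradiction)
open import Relation.Nullary.Decidable using (decidable-stable; dec-true; dec-false)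

private
  variable
    d k r t : ℕ

-- Dot products, unit vectors and dual families.

module VectorAlgebra {c ℓ} (R : CommutativeRing c ℓ) where
  open CommutativeRing R hiding (zero)
  open LinearAlgebra R public
  open SemiringSum semiring public
  open SemiringSolver commutativeSemiring public using (solve; _:=_; _:+_; _:*_; con)
  open RingProperties ring public using (-‿distribˡ-*)
  open SetoidReasoning setoid

  infix 8 _∙_

  _∙_ : Vector Carrier d → Vector Carrier d → Carrier
  u ∙ v = sum (λ i → u i * v i)

  sum-zero : (f : Vector Carrier d) → (∀ i → f i ≈ 0#) → sum f ≈ 0#
  sum-zero {d} f f≈0 = trans (sum-cong-≋ f≈0) (sum-replicate-zero d)

  ∙-cong : {u u′ v v′ : Vector Carrier d} → u ≋ u′ → v ≋ v′ → u ∙ v ≈ u′ ∙ v′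
  ∙-cong u≋u′ v≋v′ = sum-cong-≋ λ i → *-cong (u≋u′ i) (v≋v′ i)

  ∙-comm : (u v : Vector Carrier d) → u ∙ v ≈ v ∙ u
  ∙-comm u v = sum-cong-≋ λ i → *-comm (u i) (v i)

  ∙-zeroˡ : (u v : Vector Carrier d) → u ≋ 0ᵥ → u ∙ v ≈ 0#
  ∙-zeroˡ u v u≋0 = sum-zero _ λ i → trans (*-congʳ (u≋0 i)) (zeroˡ (v i))

  ∙-zeroʳ : (u v : Vector Carrier d) → v ≋ 0ᵥ → u ∙ v ≈ 0#
  ∙-zeroʳ u v v≋0 = trans (∙-comm u v) (∙-zeroˡ v u v≋0)

  ∙-linearʳ : ∀ (u v w : Vector Carrier d) x →
              u ∙ (λ i → v i + x * w i) ≈ u ∙ v + x * u ∙ w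
  ∙-linearʳ u v w x = begin
    sum (λ i → u i * (v i + x * w i))
      ≈⟨ sum-cong-≋ (λ i → solve 4 (λ u v w x → u :* (v :+ x :* w) := u :* v :+ x :* (u :* w))
                             refl (u i) (v i) (w i) x) ⟩
    sum (λ i → u i * v i + x * (u i * w i))
      ≈⟨ ∑-distrib-+ (λ i → u i * v i) (λ i → x * (u i * w i)) ⟩
    u ∙ v + sum (λ i → x * (u i * w i))
      ≈⟨ +-congˡ (*-distribˡ-sum x (λ i → u i * w i)) ⟨
    u ∙ v + x * u ∙ w ∎

  ∙-linearˡ : ∀ (u v w : Vector Carrier d) x →
              (λ i → u i + x * v i) ∙ w ≈ u ∙ w + x * v ∙ w
  ∙-linearˡ u v w x = begin
    (λ i → u i + x * v i) ∙ w    ≈⟨ ∙-comm _ w ⟩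
    w ∙ (λ i → u i + x * v i)    ≈⟨ ∙-linearʳ w u v x ⟩
    w ∙ u + x * w ∙ v            ≈⟨ +-cong (∙-comm w u) (*-congˡ (∙-comm w v)) ⟩
    u ∙ w + x * v ∙ w            ∎

  combination-∙ : ∀ (a : Vector Carrier r) (v : Vector (Vector Carrier d) r) w →
                  combination a v ∙ w ≈ sum (λ j → a j * v j ∙ w)
  combination-∙ a v w = begin
    sum (λ i → sum (λ j → a j * v j i) * w i)
      ≈⟨ sum-cong-≋ (λ i → *-distribʳ-sum (w i) (λ j → a j * v j i)) ⟩
    sum (λ i → sum (λ j → a j * v j i * w i))
      ≈⟨ ∑-comm (λ i j → a j * v j i * w i) ⟩
    sum (λ j → sum (λ i → a j * v j i * w i))
      ≈⟨ sum-cong-≋ (λ j → sum-cong-≋ λ i → *-assoc (a j) (v j i) (w i)) ⟩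
    sum (λ j → sum (λ i → a j * (v j i * w i)))
      ≈⟨ sum-cong-≋ (λ j → *-distribˡ-sum (a j) (λ i → v j i * w i)) ⟨
    sum (λ j → a j * v j ∙ w) ∎

  ∙-combination : ∀ w (a : Vector Carrier r) (v : Vector (Vector Carrier d) r) →
                  w ∙ combination a v ≈ sum (λ j → a j * w ∙ v j)
  ∙-combination w a v = begin
    w ∙ combination a v            ≈⟨ ∙-comm w _ ⟩
    combination a v ∙ w            ≈⟨ combination-∙ a v w ⟩
    sum (λ j → a j * v j ∙ w)      ≈⟨ sum-cong-≋ (λ j → *-congˡ (∙-comm (v j) w)) ⟩
    sum (λ j → a j * w ∙ v j)      ∎

  combination-cong : {a b : Vector Carrier r} {v w : Vector (Vector Carrier d) r} →
                     a ≋ b → (∀ j → v j ≋ w j) → combination a v ≋ combination b w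
  combination-cong a≋b v≋w i = sum-cong-≋ λ j → *-cong (a≋b j) (v≋w j i)

  *ᵥ-cong : (A : Matrix d) {v w : Vector Carrier d} → v ≋ w → A *ᵥ v ≋ A *ᵥ w
  *ᵥ-cong A v≋w i = ∙-cong (λ _ → refl) v≋w

  combination-∙-zero : ∀ (a : Vector Carrier r) (v : Vector (Vector Carrier d) r) w →
                       (∀ j → v j ∙ w ≈ 0#) → combination a v ∙ w ≈ 0#
  combination-∙-zero a v w v∙w≈0 = trans (combination-∙ a v w) (∙-zeroʳ a _ v∙w≈0)

  unit : Fin d → Vector Carrier d
  unit zero    = 1# ∷ 0ᵥ
  unit (suc i) = 0# ∷ unit i

  unit-∙ : ∀ (i : Fin d) v → unit i ∙ v ≈ v i
  unit-∙ zero    v = trans (+-cong (*-identityˡ _) (∙-zeroˡ 0ᵥ (tail v) λ _ → refl))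
                           (+-identityʳ _)
  unit-∙ (suc i) v = trans (+-cong (zeroˡ _) (unit-∙ i (tail v))) (+-identityˡ _)

  unit-sym : (i j : Fin d) → unit i j ≈ unit j i
  unit-sym zero    zero    = refl
  unit-sym zero    (suc j) = refl
  unit-sym (suc i) zero    = refl
  unit-sym (suc i) (suc j) = unit-sym i j

  unit-diagonal : (i : Fin d) → unit i i ≈ 1#
  unit-diagonal zero    = refl
  unit-diagonal (suc i) = unit-diagonal i

  unit-punchIn : ∀ j (i l : Fin d) → unit (punchIn j i) (punchIn j l) ≈ unit i l
  unit-punchIn zero    i       l       = refl
  unit-punchIn (suc j) zero    zero    = refl
  unit-punchIn (suc j) zero    (suc l) = refl
  unit-punchIn (suc j) (suc i) zero    = refl
  unit-punchIn (suc j) (suc i) (suc l) = unit-punchIn j i l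

  unit-punchIn-zero : ∀ j (i : Fin d) → unit (punchIn j i) j ≈ 0#
  unit-punchIn-zero zero    i       = refl
  unit-punchIn-zero (suc j) zero    = refl
  unit-punchIn-zero (suc j) (suc i) = unit-punchIn-zero j i

  combination-unit : (v : Vector Carrier d) → v ≋ combination v unit
  combination-unit v i = begin
    v i                              ≈⟨ unit-∙ i v ⟨
    unit i ∙ v                       ≈⟨ ∙-comm (unit i) v ⟩
    sum (λ j → v j * unit i j)       ≈⟨ sum-cong-≋ (λ j → *-congˡ (unit-sym i j)) ⟩
    combination v unit i             ∎

  -- Pairing a combination of the `ξ l` with `η j` reads off its coefficient `a j`.
  dual⇒independent : (η ξ : Vector (Vector Carrier d) k) → (∀ i l → η i ∙ ξ l ≈ unit i l) →
                     LinearlyIndependent ξ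
  dual⇒independent η ξ dual a aξ≋0 j = begin
    a j                            ≈⟨ unit-∙ j a ⟨
    unit j ∙ a                     ≈⟨ ∙-comm (unit j) a ⟩
    sum (λ l → a l * unit j l)     ≈⟨ sum-cong-≋ (λ l → *-congˡ (dual j l)) ⟨
    sum (λ l → a l * η j ∙ ξ l)    ≈⟨ ∙-combination (η j) a ξ ⟨
    η j ∙ combination a ξ          ≈⟨ ∙-zeroʳ (η j) _ aξ≋0 ⟩
    0#                             ∎

  span-∙-zero : ∀ {I : Set} (g : I → Vector Carrier d) {v} w → Span g v →
                (∀ i → g i ∙ w ≈ 0#) → v ∙ w ≈ 0#
  span-∙-zero g w (r , a , s , v≋) g∙w≈0 =
    trans (∙-cong v≋ (λ _ → refl)) (combination-∙-zero a (g ∘ s) w (g∙w≈0 ∘ s))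

  sum-reverse : (f : Vector Carrier d) → sum f ≈ sum (f ∘ opposite)
  sum-reverse f = sum-permute f reverse

-- Orthogonal complements by elimination over a discrete field.

module Elimination {c ℓ} (F : DiscreteField c ℓ) where
  open DiscreteField F hiding (zero)
  open VectorAlgebra commutativeRing public
  open SetoidReasoning setoid

  +-cancelʳ : ∀ z {x y} → x + z ≈ y + z → x ≈ y
  +-cancelʳ z {x} {y} = GroupProperties.∙-cancelʳ +-group z x y

  +-cancelˡ : ∀ z {x y} → z + x ≈ z + y → x ≈ y
  +-cancelˡ z {x} {y} = GroupProperties.∙-cancelˡ +-group z x y

  *-cancelˡ : ∀ {x y z} → ¬ (x ≈ 0#) → x * y ≈ x * z → y ≈ z
  *-cancelˡ {x} {y} {z} x≉0 xy≈xz = begin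
    y                  ≈⟨ cancel y ⟨
    (x ⁻¹) * (x * y)   ≈⟨ *-congˡ xy≈xz ⟩
    (x ⁻¹) * (x * z)   ≈⟨ cancel z ⟩
    z                  ∎
    where
    cancel : ∀ w → (x ⁻¹) * (x * w) ≈ w
    cancel w = begin
      (x ⁻¹) * (x * w)   ≈⟨ solve 3 (λ i x w → i :* (x :* w) := x :* i :* w) refl (x ⁻¹) x w ⟩
      x * (x ⁻¹) * w     ≈⟨ *-congʳ (⁻¹-inverse x x≉0) ⟩
      1# * w             ≈⟨ *-identityˡ w ⟩
      w                  ∎

  ⁻¹-cancelʳ : ∀ x {y} → ¬ (y ≈ 0#) → x * (y ⁻¹) * y ≈ x
  ⁻¹-cancelʳ x {y} y≉0 = begin
    x * (y ⁻¹) * y     ≈⟨ solve 3 (λ x i y → x :* i :* y := x :* (y :* i)) refl x (y ⁻¹) y ⟩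
    x * (y * (y ⁻¹))   ≈⟨ *-congˡ (⁻¹-inverse y y≉0) ⟩
    x * 1#             ≈⟨ *-identityʳ x ⟩
    x                  ∎

  data Pivot (v : Vector Carrier d) : Set ℓ where
    pivot   : ∀ j → ¬ (v j ≈ 0#) → Pivot v
    allZero : v ≋ 0ᵥ → Pivot v

  findPivot : (v : Vector Carrier d) → Pivot v
  findPivot v with any? (λ j → ¬? (v j ≟ 0#))
  ... | yes (j , vj≉0) = pivot j vj≉0
  ... | no  none       = allZero λ j → decidable-stable (v j ≟ 0#) λ vj≉0 → none (j , vj≉0)

  -- For dependent b the orthogonal complement is larger than the span of ξ; the
  -- first two properties still produce k independent vectors orthogonal to b.
  record Complement (k : ℕ) (b : Vector (Vector Carrier d) t) : Set (c ⊔ ℓ) where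
    field
      ξ η         : Vector (Vector Carrier d) k
      annihilates : ∀ i j → b i ∙ ξ j ≈ 0#
      dual        : ∀ i j → η i ∙ ξ j ≈ unit i j
      decompose   : LinearlyIndependent b → ∀ v → ∃[ a ] ∀ q →
                    v q ≈ combination a b q + combination (λ j → v ∙ ξ j) η q
      exhausts    : LinearlyIndependent b → ∀ v → (∀ i → b i ∙ v ≈ 0#) →
                    v ≋ combination (λ j → v ∙ η j) ξ

    ξ-independent : LinearlyIndependent ξ
    ξ-independent = dual⇒independent η ξ dual

    -- The `η` part of `decompose` drops out. Together with `annihilates` this makes the span of `b`
    -- the common kernel of the `ξ j`, so membership becomes a system of equations.
    spans : LinearlyIndependent b → ∀ v → (∀ j → v ∙ ξ j ≈ 0#) → Span b v
    spans indep v v∙ξ≈0 with a , v≈ ← decompose indep v = _ , a , id , λ q → begin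
      v q                                                ≈⟨ v≈ q ⟩
      combination a b q + combination (λ j → v ∙ ξ j) η q
        ≈⟨ +-congˡ (∙-zeroˡ _ (λ j → η j q) v∙ξ≈0) ⟩
      combination a b q + 0#                             ≈⟨ +-identityʳ _ ⟩
      combination a b q                                  ∎

  tail-independent : (b : Vector (Vector Carrier d) (suc t)) →
                     LinearlyIndependent b → LinearlyIndependent (tail b)
  tail-independent b indep a ab≋0 j =
    indep (0# ∷ a) (λ q → trans (+-cong (zeroˡ _) (ab≋0 q)) (+-identityˡ 0#)) (suc j)

  -- Otherwise the coefficients `- 1# ∷ a` would give a vanishing combination, and independence
  -- would force `- 1#` to be zero.
  head∉span-tail : (b : Vector (Vector Carrier d) (suc t)) → LinearlyIndependent b →
                   ∀ a → ¬ (head b ≋ combination a (tail b))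
  head∉span-tail b indep a b₀≋ = 1≉0 (begin
    1#       ≈⟨ +-identityʳ 1# ⟨
    1# + 0#  ≈⟨ +-congˡ -1≈0 ⟨
    1# + - 1# ≈⟨ -‿inverseʳ 1# ⟩
    0#       ∎)
    where
    -1≈0 : - 1# ≈ 0#
    -1≈0 = indep (- 1# ∷ a) (λ q → begin
      - 1# * head b q + combination a (tail b) q   ≈⟨ +-congˡ (b₀≋ q) ⟨
      - 1# * head b q + head b q                   ≈⟨ +-congˡ (*-identityˡ _) ⟨
      - 1# * head b q + 1# * head b q              ≈⟨ distribʳ (head b q) (- 1#) 1# ⟨
      (- 1# + 1#) * head b q                       ≈⟨ *-congʳ (-‿inverseˡ 1#) ⟩
      0# * head b q                                ≈⟨ zeroˡ _ ⟩
      0#                                           ∎) zero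

  module _ (b : Vector (Vector Carrier d) (suc t)) (C : Complement (suc k) (tail b)) where
    private
      module C = Complement C
      b₀ = head b
      bs = tail b

    -- One more vector `b₀` costs one element of the complement. If `b₀` pairs to zero with every
    -- `C.ξ j`, then for an independent tail it lies in the span of that tail, so `b` is dependent;
    -- dropping the first pair `ξ`, `η` keeps the count right. Otherwise a `C.ξ j` with non-zero
    -- pairing serves as pivot: multiples of it are added to the others to make them orthogonal to
    -- `b₀`, and it is dropped with its dual vector.
    step : Pivot (λ j → b₀ ∙ C.ξ j) → Complement k b
    step (allZero b₀∙ξ≈0) = record
      { ξ = tail C.ξ
      ; η = tail C.η
      ; annihilates = λ { zero j → b₀∙ξ≈0 (suc j) ; (suc i) j → C.annihilates i (suc j) }
      ; dual = λ i j → C.dual (suc i) (suc j)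
      ; decompose = λ indep → contradiction indep dependent
      ; exhausts = λ indep → contradiction indep dependent
      }
      where
      dependent : ¬ LinearlyIndependent b
      dependent indep with a , b₀≈ ← C.decompose (tail-independent b indep) b₀ =
        head∉span-tail b indep a λ q →
          trans (b₀≈ q) (trans (+-congˡ (∙-zeroˡ _ (λ i → C.η i q) b₀∙ξ≈0)) (+-identityʳ _))
    step (pivot j β≉0) = record
      { ξ = ξ
      ; η = η
      ; annihilates = λ
        { zero    i → trans (∙-ξ b₀ i) (eliminated i)
        ; (suc l) i → trans (∙-ξ (bs l) i) (trans
            (+-cong (C.annihilates l (punchIn j i))
                    (trans (*-congˡ (C.annihilates l j)) (zeroʳ (ρ i))))
            (+-identityˡ 0#))
        }
      -- The correction terms contribute nothing: `η` keeps only dual vectors with index different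
      -- from `j`, and these annihilate `C.ξ j`.
      ; dual = λ i l → trans (∙-ξ (η i) l) (trans
          (+-cong (trans (C.dual (punchIn j i) (punchIn j l)) (unit-punchIn j i l))
                  (trans (*-congˡ (trans (C.dual (punchIn j i) j) (unit-punchIn-zero j i)))
                         (zeroʳ (ρ l))))
          (+-identityʳ _))
      ; decompose = decompose
      ; exhausts = exhausts
      }
      where
      β : Carrier
      β = b₀ ∙ C.ξ j

      -- The multiple of the pivot vector that cancels the pairing of `b₀` with `C.ξ (punchIn j i)`.
      ρ : Vector Carrier k
      ρ i = - (b₀ ∙ C.ξ (punchIn j i)) * β ⁻¹

      ξ η : Vector (Vector Carrier d) k
      ξ i q = C.ξ (punchIn j i) q + ρ i * C.ξ j q
      η = removeAt C.η j

      ∙-ξ : ∀ v i → v ∙ ξ i ≈ v ∙ C.ξ (punchIn j i) + ρ i * v ∙ C.ξ j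
      ∙-ξ v i = ∙-linearʳ v (C.ξ (punchIn j i)) (C.ξ j) (ρ i)

      eliminated : ∀ i → b₀ ∙ C.ξ (punchIn j i) + ρ i * β ≈ 0#
      eliminated i = trans (+-congˡ (⁻¹-cancelʳ _ β≉0)) (-‿inverseʳ _)

      decompose : LinearlyIndependent b → ∀ v → ∃[ a ] ∀ q →
                  v q ≈ combination a b q + combination (λ i → v ∙ ξ i) η q
      -- The coefficient `λ′` is chosen so that `v` minus `λ′` times `b₀` pairs to zero with
      -- `C.ξ j`; the old decompositions of `v` and `b₀` then combine without an `η`-term at `j`.
      -- The semiring solver knows no negation, so `μ` is a separate variable and the zero term with
      -- factor `λ′ + μ` is inserted first.
      decompose indep v = λ′ ∷ (λ l → a l + μ * a₀ l) , λ q → begin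
        v q
          ≈⟨ v≈ q ⟩
        S q + combination (λ i → v ∙ C.ξ i) C.η q
          ≈⟨ +-congˡ (sum-remove {i = j} (λ i → v ∙ C.ξ i * C.η i q)) ⟩
        S q + (ν * C.η j q + N q)
          ≈⟨ +-identityʳ _ ⟨
        S q + (ν * C.η j q + N q) + 0#
          ≈⟨ +-congˡ (trans (*-congʳ (-‿inverseʳ λ′)) (zeroˡ _)) ⟨
        S q + (ν * C.η j q + N q) + (λ′ + μ) * (S₀ q + N₀ q)
          ≈⟨ +-congʳ (+-congˡ (+-congʳ (*-congʳ (⁻¹-cancelʳ ν β≉0)))) ⟨
        S q + (λ′ * β * C.η j q + N q) + (λ′ + μ) * (S₀ q + N₀ q)
          ≈⟨ solve 8 (λ S S₀ e N N₀ l m β →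
               S :+ (l :* β :* e :+ N) :+ (l :+ m) :* (S₀ :+ N₀) :=
               (l :* (S₀ :+ (β :* e :+ N₀)) :+ (S :+ m :* S₀)) :+ (N :+ m :* N₀))
               refl (S q) (S₀ q) (C.η j q) (N q) (N₀ q) λ′ μ β ⟩
        (λ′ * (S₀ q + (β * C.η j q + N₀ q)) + (S q + μ * S₀ q)) + (N q + μ * N₀ q)
          ≈⟨ +-congʳ (+-congʳ (*-congˡ (trans (b₀≈ q)
               (+-congˡ (sum-remove {i = j} (λ i → b₀ ∙ C.ξ i * C.η i q)))))) ⟨
        (λ′ * b₀ q + (S q + μ * S₀ q)) + (N q + μ * N₀ q)
          ≈⟨ +-cong (+-congˡ (∙-linearˡ a a₀ (λ l → bs l q) μ))
                    (trans (sum-cong-≋ λ i → *-congʳ (∙-ξ′ i))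
                           (∙-linearˡ (λ i → v ∙ C.ξ (punchIn j i)) (λ i → b₀ ∙ C.ξ (punchIn j i))
                                      (λ i → η i q) μ)) ⟨
        combination (λ′ ∷ (λ l → a l + μ * a₀ l)) b q + combination (λ i → v ∙ ξ i) η q ∎
        where
        a = proj₁ (C.decompose (tail-independent b indep) v)
        a₀ = proj₁ (C.decompose (tail-independent b indep) b₀)
        v≈ = proj₂ (C.decompose (tail-independent b indep) v)
        b₀≈ = proj₂ (C.decompose (tail-independent b indep) b₀)
        ν = v ∙ C.ξ j
        λ′ = ν * β ⁻¹
        μ = - λ′
        S = combination a bs
        S₀ = combination a₀ bs
        N = combination (λ i → v ∙ C.ξ (punchIn j i)) η
        N₀ = combination (λ i → b₀ ∙ C.ξ (punchIn j i)) η

        ∙-ξ′ : ∀ i → v ∙ ξ i ≈ v ∙ C.ξ (punchIn j i) + μ * b₀ ∙ C.ξ (punchIn j i)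
        ∙-ξ′ i = trans (∙-ξ v i) (+-congˡ (begin
          - x * β ⁻¹ * ν    ≈⟨ *-assoc (- x) (β ⁻¹) ν ⟩
          - x * (β ⁻¹ * ν)  ≈⟨ -‿distribˡ-* x _ ⟨
          - (x * (β ⁻¹ * ν))
            ≈⟨ -‿cong (solve 3 (λ x i n → x :* (i :* n) := n :* i :* x) refl x (β ⁻¹) ν) ⟩
          - (ν * β ⁻¹ * x)  ≈⟨ -‿distribˡ-* (ν * β ⁻¹) x ⟩
          μ * x             ∎))
          where x = b₀ ∙ C.ξ (punchIn j i)

      exhausts : LinearlyIndependent b → ∀ v → (∀ i → b i ∙ v ≈ 0#) →
                 v ≋ combination (λ i → v ∙ η i) ξ
      exhausts indep v b∙v≈0 q = begin
        v q
          ≈⟨ v≈ q ⟩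
        combination (λ i → v ∙ C.η i) C.ξ q
          ≈⟨ sum-remove {i = j} (λ i → v ∙ C.η i * C.ξ i q) ⟩
        v ∙ C.η j * C.ξ j q + V q
          ≈⟨ +-comm _ _ ⟩
        V q + v ∙ C.η j * C.ξ j q
          ≈⟨ +-congˡ (*-congʳ v∙ηⱼ) ⟩
        V q + sum (λ i → v ∙ η i * ρ i) * C.ξ j q
          ≈⟨ +-congˡ (*-distribʳ-sum (C.ξ j q) (λ i → v ∙ η i * ρ i)) ⟩
        V q + sum (λ i → v ∙ η i * ρ i * C.ξ j q)
          ≈⟨ ∑-distrib-+ (λ i → v ∙ η i * C.ξ (punchIn j i) q) (λ i → v ∙ η i * ρ i * C.ξ j q) ⟨
        sum (λ i → v ∙ η i * C.ξ (punchIn j i) q + v ∙ η i * ρ i * C.ξ j q)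
          ≈⟨ sum-cong-≋ (λ i → solve 4 (λ a x r y → a :* x :+ a :* r :* y := a :* (x :+ r :* y))
               refl (v ∙ η i) (C.ξ (punchIn j i) q) (ρ i) (C.ξ j q)) ⟩
        combination (λ i → v ∙ η i) ξ q ∎
        where
        V = combination (λ i → v ∙ η i) (removeAt C.ξ j)

        v≈ : v ≋ combination (λ i → v ∙ C.η i) C.ξ
        v≈ = C.exhausts (tail-independent b indep) v (b∙v≈0 ∘ suc)

        W = sum (λ i → v ∙ η i * b₀ ∙ C.ξ (punchIn j i))

        b₀∙v : β * v ∙ C.η j + W ≈ 0#
        b₀∙v = begin
          β * v ∙ C.η j + W
            ≈⟨ +-congʳ (*-comm β _) ⟩
          v ∙ C.η j * β + W
            ≈⟨ sum-remove {i = j} (λ i → v ∙ C.η i * b₀ ∙ C.ξ i) ⟨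
          sum (λ i → v ∙ C.η i * b₀ ∙ C.ξ i)
            ≈⟨ ∙-combination b₀ (λ i → v ∙ C.η i) C.ξ ⟨
          b₀ ∙ combination (λ i → v ∙ C.η i) C.ξ
            ≈⟨ ∙-cong {u = b₀} (λ _ → refl) v≈ ⟨
          b₀ ∙ v
            ≈⟨ b∙v≈0 zero ⟩
          0# ∎

        -- Orthogonality of `v` to `b₀` is one linear equation for the coordinates of `v` in `C.ξ`.
        -- Since `β` is non-zero, it determines the coordinate at `j` from the others.
        v∙ηⱼ : v ∙ C.η j ≈ sum (λ i → v ∙ η i * ρ i)
        v∙ηⱼ = *-cancelˡ β≉0 (+-cancelʳ W (begin
          β * v ∙ C.η j + W
            ≈⟨ b₀∙v ⟩
          0#
            ≈⟨ sum-zero _ (λ i → trans (*-congˡ (eliminated i)) (zeroʳ (v ∙ η i))) ⟨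
          sum (λ i → v ∙ η i * (b₀ ∙ C.ξ (punchIn j i) + ρ i * β))
            ≈⟨ sum-cong-≋ (λ i → solve 4 (λ a x r β → a :* (x :+ r :* β) := β :* (a :* r) :+ a :* x)
                 refl (v ∙ η i) (b₀ ∙ C.ξ (punchIn j i)) (ρ i) β) ⟩
          sum (λ i → β * (v ∙ η i * ρ i) + v ∙ η i * b₀ ∙ C.ξ (punchIn j i))
            ≈⟨ ∑-distrib-+ (λ i → β * (v ∙ η i * ρ i)) (λ i → v ∙ η i * b₀ ∙ C.ξ (punchIn j i)) ⟩
          sum (λ i → β * (v ∙ η i * ρ i)) + W
            ≈⟨ +-congʳ (*-distribˡ-sum β (λ i → v ∙ η i * ρ i)) ⟨
          β * sum (λ i → v ∙ η i * ρ i) + W ∎))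

  -- The standard basis, dual to itself, is the complement of the empty family; the vectors of `b`
  -- are then added one by one. Here `b` is arbitrary because a reduction does not see the promise
  -- and must compute `ξ` from every input.
  complement : t ℕ.+ k ≡ d → (b : Vector (Vector Carrier d) t) → Complement k b
  complement {zero} ≡.refl b = record
    { ξ = unit
    ; η = unit
    ; annihilates = λ ()
    ; dual = λ i j → trans (unit-∙ i (unit j)) (unit-sym j i)
    ; decompose = λ _ v → (λ ()) , λ q → trans (expand v q) (sym (+-identityˡ _))
    ; exhausts = λ _ v _ → expand v
    }
    where
    expand : ∀ v → v ≋ combination (λ j → v ∙ unit j) unit
    expand v q = trans (combination-unit v q)
      (combination-cong {v = unit} (λ j → sym (trans (∙-comm v (unit j)) (unit-∙ j v)))
                        (λ _ _ → refl) q)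
  complement {suc t} {k} t+k≡d b =
    step b C (findPivot (λ j → head b ∙ Complement.ξ C j))
    where C = complement (≡.trans (ℕₚ.+-suc t k) t+k≡d) (tail b)

-- Linear recurrences with ascending coefficients.

module LinearRecurrences {c ℓ} (R : CommutativeRing c ℓ) where
  open CommutativeRing R hiding (zero)
  open VectorAlgebra R
  open Recurrence R public
  open SetoidReasoning setoid

  -- The recurrence with ascending coefficients: e i multiplies the i-th oldest term.
  Ascending : Vector Carrier d → (ℕ → Carrier) → Set ℓ
  Ascending {d} e s = ∀ n → s (n ℕ.+ d) ≈ sum (λ j → e j * s (n ℕ.+ toℕ j))

  -- Reversal of the summation order. With `s` the powers of `z` and `n` zero it also rewrites the
  -- characteristic polynomial. The vector `e` is kept apart from `c ∘ opposite` because reversing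
  -- twice gives back a vector only up to a proved equality.
  sum-ascending : (c e : Vector Carrier d) → c ∘ opposite ≋ e → ∀ (s : ℕ → Carrier) n →
                  sum (λ i → c i * s (n ℕ.+ d ∸ suc (toℕ i))) ≈
                  sum (λ j → e j * s (n ℕ.+ toℕ j))
  sum-ascending {d} c e c≋e s n = begin
    sum (λ i → c i * s (n ℕ.+ d ∸ suc (toℕ i)))
      ≈⟨ sum-reverse (λ i → c i * s (n ℕ.+ d ∸ suc (toℕ i))) ⟩
    sum (λ j → c (opposite j) * s (n ℕ.+ d ∸ suc (toℕ (opposite j))))
      ≈⟨ sum-cong-≋ (λ j → *-cong (c≋e j) (reflexive (cong s (index j)))) ⟩
    sum (λ j → e j * s (n ℕ.+ toℕ j)) ∎
    where
    index : ∀ (j : Fin d) → n ℕ.+ d ∸ suc (toℕ (opposite j)) ≡ n ℕ.+ toℕ j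
    index j = ≡.trans (ℕₚ.+-∸-assoc n (toℕ<n (opposite j)))
      (cong (n ℕ.+_) (≡.trans (≡.sym (opposite-prop (opposite j)))
                              (cong toℕ (opposite-involutive j))))

  satisfies⇒ascending : ∀ (c : Vector Carrier d) {s} →
                        Satisfies c s → Ascending (c ∘ opposite) s
  satisfies⇒ascending {d} c {s} sat n =
    trans (sat (n ℕ.+ d) (ℕₚ.m≤n+m d n)) (sum-ascending c (c ∘ opposite) (λ _ → refl) s n)

  ascending⇒satisfies : ∀ (e : Vector Carrier d) {s} →
                        Ascending e s → Satisfies (e ∘ opposite) s
  ascending⇒satisfies {d} e {s} asc n d≤n =
    subst (λ m → s m ≈ sum (λ i → e (opposite i) * s (m ∸ suc (toℕ i)))) (ℕₚ.m∸n+n≡m d≤n)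
      (trans (asc (n ∸ d)) (sym (sum-ascending (e ∘ opposite) e
        (λ j → reflexive (cong e (opposite-involutive j))) s (n ∸ d))))

  -- Both sequences agree with the `lrs` whose initial values are those of `s′`.
  ascending-unique : ∀ (e : Vector Carrier d) {s s′} → Ascending e s → Ascending e s′ →
                     (∀ (j : Fin d) → s (toℕ j) ≈ s′ (toℕ j)) → ∀ n → s n ≈ s′ n
  ascending-unique e {s} {s′} asc asc′ initial n = trans
    (lrs-unique (e ∘ opposite) (s′ ∘ toℕ) s (ascending⇒satisfies e asc) initial n)
    (sym (lrs-unique (e ∘ opposite) (s′ ∘ toℕ) s′ (ascending⇒satisfies e asc′) (λ _ → refl) n))

  ascending-0 : (e : Vector Carrier d) → Ascending e (λ _ → 0#)
  ascending-0 e n = sym (∙-zeroʳ e 0ᵥ λ _ → refl)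

  ascending-sum : ∀ (e : Vector Carrier d) (a : Vector Carrier r) (s : Vector (ℕ → Carrier) r) →
                  (∀ l → Ascending e (s l)) → Ascending e (λ n → sum (λ l → a l * s l n))
  ascending-sum {d} e a s asc n = begin
    sum (λ l → a l * s l (n ℕ.+ d))
      ≈⟨ sum-cong-≋ (λ l → *-congˡ (asc l n)) ⟩
    sum (λ l → a l * e ∙ (λ j → s l (n ℕ.+ toℕ j)))
      ≈⟨ ∙-combination e a (λ l j → s l (n ℕ.+ toℕ j)) ⟨
    e ∙ combination a (λ l j → s l (n ℕ.+ toℕ j)) ∎

  ascending-shift : ∀ (e : Vector Carrier d) s m → Ascending e s → Ascending e (λ n → s (m ℕ.+ n))
  ascending-shift e s zero    asc = asc
  ascending-shift e s (suc m) asc = ascending-shift e (s ∘ suc) m (asc ∘ suc)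

  lrs-ascending : (c a : Vector Carrier d) → Ascending (c ∘ opposite) (lrs c a)
  lrs-ascending c a = satisfies⇒ascending c (lrs-satisfies c a)

  -- The coordinates of Xⁿ modulo the characteristic polynomial.
  fundamental : Vector Carrier d → ℕ → Vector Carrier d
  fundamental c n p = lrs c (unit p) n

  fundamental-initial : ∀ (c : Vector Carrier d) i → fundamental c (toℕ i) ≋ unit i
  fundamental-initial c i p = trans (reflexive (lrs-initial c (unit p) i)) (unit-sym p i)

  -- Both sides satisfy the recurrence in `n`, and among the first `d` indices `fundamental c n` is
  -- a unit vector that selects the matching initial value.
  expand : ∀ (c : Vector Carrier d) {s} → Ascending (c ∘ opposite) s →
           ∀ n → s n ≈ fundamental c n ∙ (s ∘ toℕ)
  expand c {s} asc n = trans
    (ascending-unique (c ∘ opposite) asc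
      (ascending-sum (c ∘ opposite) (s ∘ toℕ) (λ p → lrs c (unit p))
        (λ p → lrs-ascending c (unit p)))
      (λ i → trans (sym (unit-∙ i (s ∘ toℕ)))
        (trans (∙-comm (unit i) (s ∘ toℕ))
               (sum-cong-≋ λ p → *-congˡ (sym (fundamental-initial c i p)))))
      n)
    (∙-comm (s ∘ toℕ) (fundamental c n))

  expand-lrs : ∀ (c a : Vector Carrier d) n → lrs c a n ≈ fundamental c n ∙ a
  expand-lrs c a n = trans (expand c (lrs-ascending c a) n)
    (∙-cong {u = fundamental c n} (λ _ → refl) λ i → reflexive (lrs-initial c a i))

-- Linear relations along an orbit, eigenvalues and characteristic roots.

module Krylov {c ℓ} (F : DiscreteField c ℓ) where
  open DiscreteField F hiding (zero)
  open Elimination F public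
  open LinearRecurrences commutativeRing public
  open RawSemiringDefinitions (RawRing.rawSemiring rawRing) using (_^_)
  open SetoidReasoning setoid

  normalise : Vector Carrier (suc r) → Vector Carrier r
  normalise p j = - init p j * last p ⁻¹

  solve-last : ∀ (p : Vector Carrier (suc r)) (v : Vector (Vector Carrier d) (suc r)) →
               ¬ (last p ≈ 0#) → combination p v ≋ 0ᵥ →
               last v ≋ combination (normalise p) (init v)
  -- After multiplication by `last p` and addition of `S` both sides are zero: the left by the given
  -- relation, the right by the choice of `normalise`.
  solve-last p v p≉0 pv≋0 q = *-cancelˡ p≉0 (+-cancelʳ S (begin
    last p * last v q + S
      ≈⟨ +-comm _ S ⟩
    S + last p * last v q
      ≈⟨ sum-init-last (λ j → p j * v j q) ⟨
    combination p v q
      ≈⟨ pv≋0 q ⟩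
    0#
      ≈⟨ ∙-zeroˡ _ (λ j → init v j q) (λ j →
           trans (+-congˡ (⁻¹-cancelʳ _ p≉0)) (-‿inverseʳ _)) ⟨
    sum (λ j → (init p j + normalise p j * last p) * init v j q)
      ≈⟨ sum-cong-≋ (λ j → solve 4 (λ a n l v → (a :+ n :* l) :* v := a :* v :+ l :* (n :* v))
           refl (init p j) (normalise p j) (last p) (init v j q)) ⟩
    sum (λ j → init p j * init v j q + last p * (normalise p j * init v j q))
      ≈⟨ ∑-distrib-+ (λ j → init p j * init v j q) (λ j → last p * (normalise p j * init v j q)) ⟩
    S + sum (λ j → last p * (normalise p j * init v j q))
      ≈⟨ +-congˡ (*-distribˡ-sum (last p) (λ j → normalise p j * init v j q)) ⟨
    S + last p * combination (normalise p) (init v) q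
      ≈⟨ +-comm S _ ⟩
    last p * combination (normalise p) (init v) q + S ∎))
    where S = combination (init p) (init v) q

  solve-relation : ∀ (w : ℕ → Vector Carrier d) (p : Vector Carrier (suc r)) → ¬ (last p ≈ 0#) →
                   combination p (w ∘ toℕ) ≋ 0ᵥ → w r ≋ combination (normalise p) (w ∘ toℕ)
  solve-relation {r = r} w p p≉0 pw≋0 q = begin
    w r q
      ≈⟨ reflexive (cong (λ n → w n q) (toℕ-fromℕ r)) ⟨
    w (toℕ (fromℕ r)) q
      ≈⟨ solve-last p (w ∘ toℕ) p≉0 pw≋0 q ⟩
    combination (normalise p) (init (w ∘ toℕ)) q
      ≈⟨ combination-cong {a = normalise p} (λ _ → refl)
           (λ j q → reflexive (cong (λ n → w n q) (toℕ-inject₁ j))) q ⟩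
    combination (normalise p) (w ∘ toℕ) q ∎

  vanishing-relation : ∀ (w : ℕ → Vector Carrier d) (p : Vector Carrier (suc r)) → last p ≈ 0# →
                       LinearlyIndependent {r = r} (w ∘ toℕ) → combination p (w ∘ toℕ) ≋ 0ᵥ → p ≋ 0ᵥ
  vanishing-relation w p pᵣ≈0 indep pw≋0 j = case (view j)
    where
    init≋0 : init p ≋ 0ᵥ
    init≋0 = indep (init p) λ q → begin
      combination (init p) (w ∘ toℕ) q
        ≈⟨ combination-cong {a = init p} (λ _ → refl)
             (λ j q → reflexive (cong (λ n → w n q) (toℕ-inject₁ j))) q ⟨
      combination (init p) (init (w ∘ toℕ)) q
        ≈⟨ +-identityʳ _ ⟨
      combination (init p) (init (w ∘ toℕ)) q + 0#
        ≈⟨ +-congˡ (trans (*-congʳ pᵣ≈0) (zeroˡ (last (w ∘ toℕ) q))) ⟨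
      combination (init p) (init (w ∘ toℕ)) q + last p * last (w ∘ toℕ) q
        ≈⟨ sum-init-last (λ j → p j * w (toℕ j) q) ⟨
      combination p (w ∘ toℕ) q
        ≈⟨ pw≋0 q ⟩
      0# ∎

    case : ∀ {j} → View j → p j ≈ 0#
    case ‵fromℕ        = pᵣ≈0
    case (‵inject₁ j) = init≋0 j

  -- Division of Xᵈ - Σ eⱼ Xʲ by X - z with quotient q, applied to the functional
  -- Xⁱ ↦ s i, with all terms moved so that no subtraction occurs.
  synthetic-division : ∀ (e : Vector Carrier d) z → Σ (Vector Carrier d) λ q → ∀ (s : ℕ → Carrier) →
    s d + sum (λ i → q i * (z * s (toℕ i))) + sum (λ j → e j * z ^ toℕ j) * s 0 ≈
    sum (λ j → e j * s (toℕ j)) + sum (λ i → q i * s (suc (toℕ i))) + z ^ d * s 0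
  synthetic-division {zero} e z = (λ ()) , λ s →
    solve 1 (λ x → x :+ con 0 :+ con 0 :* x := con 0 :+ con 0 :+ con 1 :* x) refl (s 0)
  -- The induction divides the polynomial with coefficients `tail e` and applies the result to
  -- `s ∘ suc`, which amounts to multiplying by X. The summand `E * s 1` on both sides lets `q₀ + E`
  -- be exchanged for `z ^ d`.
  synthetic-division {suc d} e z = q₀ ∷ q , λ s → +-cancelʳ (E * s 1) (begin
    s (suc d) + (q₀ * (z * s 0) + Q₀ s) + (e zero * 1# + E′) * s 0 + E * s 1
      ≈⟨ +-congʳ (+-congˡ (*-congʳ (+-congˡ E′≈))) ⟩
    s (suc d) + (q₀ * (z * s 0) + Q₀ s) + (e zero * 1# + z * E) * s 0 + E * s 1
      ≈⟨ solve 8 (λ sd q₀ z s₀ Q₀ e₀ E s₁ →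
           sd :+ (q₀ :* (z :* s₀) :+ Q₀) :+ (e₀ :* con 1 :+ z :* E) :* s₀ :+ E :* s₁ :=
           (sd :+ Q₀ :+ E :* s₁) :+ (e₀ :* s₀ :+ z :* (q₀ :+ E) :* s₀))
           refl (s (suc d)) q₀ z (s 0) (Q₀ s) (e zero) E (s 1) ⟩
    (s (suc d) + Q₀ s + E * s 1) + (e zero * s 0 + z * (q₀ + E) * s 0)
      ≈⟨ +-cong (division (s ∘ suc)) (+-congˡ (*-congʳ (*-congˡ q₀+E≈))) ⟩
    (S s + Q₁ s + z ^ d * s 1) + (e zero * s 0 + z ^ suc d * s 0)
      ≈⟨ +-congʳ (+-congˡ (*-congʳ q₀+E≈)) ⟨
    (S s + Q₁ s + (q₀ + E) * s 1) + (e zero * s 0 + z ^ suc d * s 0)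
      ≈⟨ solve 7 (λ S Q₁ q₀ E s₁ x y →
           (S :+ Q₁ :+ (q₀ :+ E) :* s₁) :+ (x :+ y) :=
           (x :+ S) :+ (q₀ :* s₁ :+ Q₁) :+ y :+ E :* s₁)
           refl (S s) (Q₁ s) q₀ E (s 1) (e zero * s 0) (z ^ suc d * s 0) ⟩
    (e zero * s 0 + S s) + (q₀ * s 1 + Q₁ s) + z ^ suc d * s 0 + E * s 1 ∎)
    where
    E = sum (λ j → e (suc j) * z ^ toℕ j)
    E′ = sum (λ j → e (suc j) * z ^ suc (toℕ j))
    -- The remainder of the inner division, that is the value at `z` of the inner polynomial. It
    -- becomes the constant coefficient of the new quotient.
    q₀ = z ^ d + - E
    q = proj₁ (synthetic-division (tail e) z)
    division = proj₂ (synthetic-division (tail e) z)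

    q₀+E≈ : q₀ + E ≈ z ^ d
    q₀+E≈ = trans (+-assoc _ _ _) (trans (+-congˡ (-‿inverseˡ E)) (+-identityʳ _))

    E′≈ : E′ ≈ z * E
    E′≈ = trans
      (sum-cong-≋ λ j → solve 3 (λ e z p → e :* (z :* p) := z :* (e :* p))
         refl (e (suc j)) z (z ^ toℕ j))
      (sym (*-distribˡ-sum z (λ j → e (suc j) * z ^ toℕ j)))

    S Q₀ Q₁ : (ℕ → Carrier) → Carrier
    S s = sum (λ j → e (suc j) * s (suc (toℕ j)))
    Q₀ s = sum (λ i → q i * (z * s (suc (toℕ i))))
    Q₁ s = sum (λ i → q i * s (suc (suc (toℕ i))))

  module Sequence (A : Matrix d) (w : ℕ → Vector Carrier d)
                  (w-suc : ∀ n → w (suc n) ≋ A *ᵥ w n) where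

    relation-shift : ∀ (a : Vector Carrier r) → w r ≋ combination a (w ∘ toℕ) →
                     ∀ n → w (n ℕ.+ r) ≋ combination a (λ j → w (n ℕ.+ toℕ j))
    relation-shift {r} a rel zero    = rel
    relation-shift {r} a rel (suc n) i = begin
      w (suc n ℕ.+ r) i                                    ≈⟨ w-suc (n ℕ.+ r) i ⟩
      (A *ᵥ w (n ℕ.+ r)) i                                 ≈⟨ *ᵥ-cong A (relation-shift a rel n) i ⟩
      (A *ᵥ combination a (λ j → w (n ℕ.+ toℕ j))) i
        ≈⟨ ∙-combination (A i) a (λ j → w (n ℕ.+ toℕ j)) ⟩
      combination a (λ j → A *ᵥ w (n ℕ.+ toℕ j)) i
        ≈⟨ combination-cong {a = a} (λ _ → refl) (λ j → w-suc (n ℕ.+ toℕ j)) i ⟨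
      combination a (λ j → w (suc n ℕ.+ toℕ j)) i          ∎

    relation-ascending : ∀ (a : Vector Carrier r) → w r ≋ combination a (w ∘ toℕ) →
                         ∀ f → Ascending a (λ n → w n ∙ f)
    relation-ascending a rel f n =
      trans (∙-cong {v = f} (relation-shift a rel n) (λ _ → refl))
            (combination-∙ a (λ j → w (n ℕ.+ toℕ j)) f)

    module _ (full : ∀ f → (∀ n → w n ∙ f ≈ 0#) → f ≋ 0ᵥ) where

      -- Fewer than `d` vectors leave a vector `ξ zero` orthogonal to all of them. Its pairings with
      -- the orbit satisfy the recurrence `a` with zero initial values, so they all vanish, and
      -- `full` makes `ξ zero` zero, contrary to duality. The hypothesis `full` is the dual form of
      -- the statement that the orbit spans the space.
      no-short-relation : ∀ (a : Vector Carrier r) → r < d → ¬ (w r ≋ combination a (w ∘ toℕ))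
      no-short-relation {r} a r<d rel =
        1≉0 (trans (sym (dual zero zero)) (∙-zeroʳ (η zero) (ξ zero) ξ₀≋0))
        where
        C : Complement (suc (d ∸ suc r)) (λ (j : Fin r) → w (toℕ j))
        C = complement (≡.trans (ℕₚ.+-suc r _) (ℕₚ.m+[n∸m]≡n r<d)) _
        open Complement C

        ξ₀≋0 : ξ zero ≋ 0ᵥ
        ξ₀≋0 = full (ξ zero) (ascending-unique a (relation-ascending a rel (ξ zero))
                                (ascending-0 a) (λ j → annihilates j zero))

      -- Induction on `r`: a non-zero last coefficient could be solved for, giving a short relation;
      -- a zero one leaves a relation among fewer vectors.
      initial-independent : r ≤ d → LinearlyIndependent {r = r} (w ∘ toℕ)
      initial-independent {zero}  _   a aw≋0 ()
      initial-independent {suc r} r<d a aw≋0 with last a ≟ 0#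
      ... | no  aᵣ≉0 =
        contradiction (solve-relation w a aᵣ≉0 aw≋0) (no-short-relation (normalise a) r<d)
      ... | yes aᵣ≈0 =
        vanishing-relation w a aᵣ≈0 (initial-independent (ℕₚ.<⇒≤ r<d)) aw≋0

      -- Let p be the monic polynomial of the relation and q its quotient by X - z. The eigenvector
      -- is q(A) applied to `w 0`: multiplying it by A - z gives p(A) applied to `w 0`, which is
      -- zero.
      root⇒eigenvector : ∀ (e : Vector Carrier d) → w d ≋ combination e (w ∘ toℕ) →
                         ∀ z → z ^ d ≈ sum (λ j → e j * z ^ toℕ j) →
                         Σ (Vector Carrier d) λ v → ¬ (v ≋ 0ᵥ) × A *ᵥ v ≋ map (z *_) v
      root⇒eigenvector e rel z root = v , v≉0 , Av≋zv
        where
        q = proj₁ (synthetic-division e z)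
        v = combination q (λ i → w (toℕ i))

        division : ∀ (s : ℕ → Carrier) →
          s d + sum (λ i → q i * (z * s (toℕ i))) ≈
          sum (λ j → e j * s (toℕ j)) + sum (λ i → q i * s (suc (toℕ i)))
        division s = +-cancelʳ _ (trans (proj₂ (synthetic-division e z) s)
                                        (+-congˡ (*-congʳ root)))

        Av≋zv : A *ᵥ v ≋ map (z *_) v
        Av≋zv p = begin
          (A *ᵥ v) p                               ≈⟨ ∙-combination (A p) q (w ∘ toℕ) ⟩
          sum (λ i → q i * (A *ᵥ w (toℕ i)) p)
            ≈⟨ combination-cong {a = q} (λ _ → refl) (λ i → w-suc (toℕ i)) p ⟨
          sum (λ i → q i * w (suc (toℕ i)) p)
            ≈⟨ +-cancelˡ (w d p) (trans (division (λ n → w n p)) (+-congʳ (sym (rel p)))) ⟨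
          sum (λ i → q i * (z * w (toℕ i) p))
            ≈⟨ sum-cong-≋ (λ i → solve 3 (λ q z x → q :* (z :* x) := z :* (q :* x))
                 refl (q i) z (w (toℕ i) p)) ⟩
          sum (λ i → z * (q i * w (toℕ i) p))      ≈⟨ *-distribˡ-sum z (λ i → q i * w (toℕ i) p) ⟨
          z * v p                                  ∎

        v≉0 : ¬ (v ≋ 0ᵥ)
        -- Independence of the first `d` orbit vectors would make the quotient zero. The functional
        -- `δ`, which reads off the coefficient at degree `d`, then contradicts that the divided
        -- polynomial is monic.
        v≉0 v≋0 = 1≉0 (begin
          1#
            ≈⟨ reflexive (cong (λ b → if b then 1# else 0#) (dec-true (d ℕₚ.≟ d) ≡.refl)) ⟨
          δ d
            ≈⟨ trans (+-congˡ (∙-zeroˡ q (λ i → z * δ (toℕ i)) q≋0)) (+-identityʳ _) ⟨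
          δ d + sum (λ i → q i * (z * δ (toℕ i)))
            ≈⟨ division δ ⟩
          sum (λ j → e j * δ (toℕ j)) + sum (λ i → q i * δ (suc (toℕ i)))
            ≈⟨ +-cong (∙-zeroʳ e (δ ∘ toℕ) λ j → reflexive
                        (cong (λ b → if b then 1# else 0#)
                              (dec-false (toℕ j ℕₚ.≟ d) (ℕₚ.<⇒≢ (toℕ<n j)))))
                      (∙-zeroˡ q (λ i → δ (suc (toℕ i))) q≋0) ⟩
          0# + 0#
            ≈⟨ +-identityˡ 0# ⟩
          0# ∎)
          where
          q≋0 : q ≋ 0ᵥ
          q≋0 = initial-independent ℕₚ.≤-refl q v≋0

          δ : ℕ → Carrier
          δ n = if does (n ℕₚ.≟ d) then 1# else 0#

  -- If the constant coefficient were zero, the relation would involve only `w 1` to `w d` and be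
  -- too short for the shifted orbit `w ∘ suc`, which is still full.
  constant-coefficient≉0 :
    ∀ (A : Matrix d) w → (∀ n → w (suc n) ≋ A *ᵥ w n) →
    (∀ f → (∀ n → w (suc n) ∙ f ≈ 0#) → f ≋ 0ᵥ) →
    ∀ (e : Vector Carrier d) → w d ≋ combination e (w ∘ toℕ) →
    ∀ i → toℕ i ≡ 0 → ¬ (e i ≈ 0#)
  constant-coefficient≉0 A w w-suc full e rel zero _ e₀≈0 =
    Sequence.no-short-relation A (w ∘ suc) (w-suc ∘ suc) full (tail e) (ℕₚ.n<1+n _) λ q →
      trans (rel q) (trans (+-congʳ (trans (*-congʳ e₀≈0) (zeroˡ (w 0 q)))) (+-identityˡ _))

  -- With an invertible constant coefficient the recurrence also determines each term from the later
  -- ones, so zeros propagate backwards.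
  ascending-backward : ∀ (e : Vector Carrier (suc d)) → ¬ (e zero ≈ 0#) →
                       ∀ s m → Ascending e s → (∀ n → s (m ℕ.+ n) ≈ 0#) → ∀ n → s n ≈ 0#
  ascending-backward         e e₀≉0 s zero    asc s≈0 = s≈0
  ascending-backward {d = d} e e₀≉0 s (suc m) asc s≈0 = vanish
    where
    later : ∀ n → s (suc n) ≈ 0#
    later = ascending-backward e e₀≉0 (s ∘ suc) m (asc ∘ suc) s≈0

    vanish : ∀ n → s n ≈ 0#
    vanish (suc n) = later n
    vanish zero    = *-cancelˡ e₀≉0 (begin
      e zero * s 0
        ≈⟨ +-identityʳ _ ⟨
      e zero * s 0 + 0#
        ≈⟨ +-congˡ (∙-zeroʳ (tail e) (λ j → s (suc (toℕ j))) (λ j → later (toℕ j))) ⟨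
      sum (λ j → e j * s (toℕ j))
        ≈⟨ asc 0 ⟨
      s (suc d)
        ≈⟨ later d ⟩
      0#
        ≈⟨ zeroʳ (e zero) ⟨
      e zero * 0# ∎)

  -- The companion matrix of a recurrence.

  module Companion (c : Vector Carrier d) where

    -- Multiplication by X modulo the characteristic polynomial: column `j` holds the coordinates of
    -- the power of X with exponent `suc (toℕ j)`.
    companion : Matrix d
    companion p j = fundamental c (suc (toℕ j)) p

    -- Row `p` of `companion` consists of the initial values of the shifted sequence
    -- `lrs c (unit p) ∘ suc`, so `expand` applies to that sequence.
    fundamental-suc : ∀ n → fundamental c (suc n) ≋ companion *ᵥ fundamental c n
    fundamental-suc n p = trans (expand c (lrs-ascending c (unit p) ∘ suc) n)
                                (∙-comm (fundamental c n) (companion p))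

    -- By trajectory-zero and trajectory-suc, trajectory a n is companionⁿ a.
    trajectory : Vector Carrier d → ℕ → Vector Carrier d
    trajectory a n = combination a (λ j → fundamental c (toℕ j ℕ.+ n))

    trajectory-zero : ∀ a → trajectory a 0 ≋ a
    trajectory-zero a q = trans
      (combination-cong {a = a} {w = unit} (λ _ → refl) (λ j q → trans
        (reflexive (cong (λ n → fundamental c n q) (ℕₚ.+-identityʳ (toℕ j))))
        (fundamental-initial c j q)) q)
      (sym (combination-unit a q))

    trajectory-suc : ∀ a n → trajectory a (suc n) ≋ companion *ᵥ trajectory a n
    trajectory-suc a n q = trans
      (combination-cong {a = a} (λ _ → refl) (λ j q → trans
        (reflexive (cong (λ n → fundamental c n q) (ℕₚ.+-suc (toℕ j) n)))
        (fundamental-suc (toℕ j ℕ.+ n) q)) q)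
      (sym (∙-combination (companion q) a (λ j → fundamental c (toℕ j ℕ.+ n))))

    trajectory-ascending : ∀ a q → Ascending (c ∘ opposite) (λ n → trajectory a n q)
    trajectory-ascending a q =
      ascending-sum (c ∘ opposite) a (λ j n → fundamental c (toℕ j ℕ.+ n) q)
        (λ j → ascending-shift (c ∘ opposite) (lrs c (unit q)) (toℕ j) (lrs-ascending c (unit q)))

    -- On an eigenvector the trajectory is geometric, and each of its coordinates satisfies the
    -- recurrence. At a coordinate where `v` is non-zero, the recurrence at index 0 divided by `v i`
    -- is the characteristic equation.
    eigenvalue⇒root : ∀ z v → ¬ (v ≋ 0ᵥ) → companion *ᵥ v ≋ map (z *_) v →
                      z ^ d ≈ sum (λ j → c (opposite j) * z ^ toℕ j)
    eigenvalue⇒root z v v≉0 Av≋zv with findPivot v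
    ... | allZero v≋0  = contradiction v≋0 v≉0
    ... | pivot i vᵢ≉0 = *-cancelˡ vᵢ≉0 (begin
      v i * z ^ d
        ≈⟨ *-comm _ _ ⟩
      z ^ d * v i
        ≈⟨ geometric d i ⟨
      trajectory v d i
        ≈⟨ trajectory-ascending v i 0 ⟩
      sum (λ j → c (opposite j) * trajectory v (toℕ j) i)
        ≈⟨ sum-cong-≋ (λ j → trans (*-congˡ (geometric (toℕ j) i))
             (solve 3 (λ c z v → c :* (z :* v) := v :* (c :* z))
               refl (c (opposite j)) (z ^ toℕ j) (v i))) ⟩
      sum (λ j → v i * (c (opposite j) * z ^ toℕ j))
        ≈⟨ *-distribˡ-sum (v i) (λ j → c (opposite j) * z ^ toℕ j) ⟨
      v i * sum (λ j → c (opposite j) * z ^ toℕ j) ∎)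
      where
      geometric : ∀ n → trajectory v n ≋ map (z ^ n *_) v
      geometric zero    q = trans (trajectory-zero v q) (sym (*-identityˡ _))
      geometric (suc n) q = begin
        trajectory v (suc n) q
          ≈⟨ trajectory-suc v n q ⟩
        (companion *ᵥ trajectory v n) q
          ≈⟨ *ᵥ-cong companion (geometric n) q ⟩
        sum (λ j → companion q j * (z ^ n * v j))
          ≈⟨ sum-cong-≋ (λ j → solve 3 (λ a z v → a :* (z :* v) := z :* (a :* v))
               refl (companion q j) (z ^ n) (v j)) ⟩
        sum (λ j → z ^ n * (companion q j * v j))
          ≈⟨ *-distribˡ-sum (z ^ n) (λ j → companion q j * v j) ⟨
        z ^ n * (companion *ᵥ v) q
          ≈⟨ *-congˡ (Av≋zv q) ⟩
        z ^ n * (z * v q)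
          ≈⟨ solve 3 (λ z p v → p :* (z :* v) := z :* p :* v) refl z (z ^ n) (v q) ⟩
        z ^ suc n * v q ∎

  -- A vanishing combination says that the trajectory of `a` is zero at time `m`, hence from then
  -- on. Running the recurrence backwards makes it zero at time 0, where it equals `a`.
  fundamental-independent : ∀ (c : Vector Carrier d) → (∀ i → suc (toℕ i) ≡ d → ¬ (c i ≈ 0#)) →
                            ∀ m → LinearlyIndependent (λ (j : Fin d) → fundamental c (m ℕ.+ toℕ j))
  fundamental-independent {suc d} c c≉0 m a aw≋0 q =
    trans (sym (trajectory-zero a q))
          (ascending-backward (c ∘ opposite) (c≉0 (fromℕ d) (cong suc (toℕ-fromℕ d)))
             (λ n → trajectory a n q) m (trajectory-ascending a q) (λ n → vanish n q) 0)
    where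
    open Companion c

    vanish : ∀ n → trajectory a (m ℕ.+ n) ≋ 0ᵥ
    vanish zero    q = trans
      (combination-cong {a = a} (λ _ → refl) (λ j q → reflexive (cong (λ n → fundamental c n q)
        (≡.trans (ℕₚ.+-comm (toℕ j) _) (cong (ℕ._+ toℕ j) (ℕₚ.+-identityʳ m))))) q)
      (aw≋0 q)
    vanish (suc n) q = begin
      trajectory a (m ℕ.+ suc n) q
        ≈⟨ reflexive (cong (λ n → trajectory a n q) (ℕₚ.+-suc m n)) ⟩
      trajectory a (suc (m ℕ.+ n)) q          ≈⟨ trajectory-suc a (m ℕ.+ n) q ⟩
      (companion *ᵥ trajectory a (m ℕ.+ n)) q ≈⟨ ∙-zeroʳ (companion q) _ (vanish n) ⟩
      0#                                      ∎

-- Transfer from `K` to the algebraic numbers, and the two reductions.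

module Reductions {c ℓ p} (ℚ̄ : AlgebraicNumbers c ℓ)
                  (𝕂 : Subfield (AlgebraicNumbers.discreteField ℚ̄) p) where
  open AlgebraicNumbers ℚ̄ hiding (zero; sum)
  open Subfield 𝕂
  open Problems ℚ̄ 𝕂
  open Krylov discreteField
  open SetoidReasoning setoid

  K-discreteField : DiscreteField (c ⊔ p) ℓ
  K-discreteField = record
    { commutativeRing = K-commutativeRing
    ; _≟_             = λ x y → ι x ≟ ι y
    ; 1≉0             = 1≉0
    ; _⁻¹             = inv
    ; ⁻¹-inverse      = inv-inverse
    }
    where
    -- Closure under inverses is given only for non-zero elements, so zero is sent to zero by
    -- default.
    inv : K → K
    inv (x , x∈K) with x ≟ 0#
    ... | yes _  = 0# , 0∈K
    ... | no x≉0 = x ⁻¹ , ⁻¹-closed x≉0 x∈K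

    inv-inverse : ∀ x → ¬ (ι x ≈ 0#) → ι x * ι (inv x) ≈ 1#
    inv-inverse (x , x∈K) x≉0 with x ≟ 0#
    ... | yes x≈0 = contradiction x≈0 x≉0
    ... | no  x≉0 = ⁻¹-inverse x x≉0

  module Kᶠ = Krylov K-discreteField
  open Kᶠ using () renaming (_∙_ to _∙ₖ_)
  open CommutativeRing K-commutativeRing using () renaming (_*_ to _*ₖ_)

  ι-sum : (f : Vector K d) → ι (Kᶠ.sum f) ≡ sum (ι ∘ f)
  ι-sum {zero}  f = ≡.refl
  ι-sum {suc d} f = cong (ι (f zero) +_) (ι-sum (tail f))

  ι-∙ : (u v : Vector K d) → ι (u ∙ₖ v) ≈ (ι ∘ u) ∙ (ι ∘ v)
  ι-∙ u v = reflexive (ι-sum (λ i → u i *ₖ v i))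

  ι-combination : (a : Vector K r) (v : Vector (Vector K d) r) →
                  ι ∘ Kᶠ.combination a v ≋ combination (ι ∘ a) (map (map ι) v)
  ι-combination a v i = reflexive (ι-sum (λ j → a j *ₖ v j i))

  ι-unit : (i j : Fin d) → ι (Kᶠ.unit i j) ≡ unit i j
  ι-unit zero    zero    = ≡.refl
  ι-unit zero    (suc j) = ≡.refl
  ι-unit (suc i) zero    = ≡.refl
  ι-unit (suc i) (suc j) = ι-unit i j

  ι-span : ∀ {I : Set} (g : I → Vector K d) v → Kᶠ.Span g v → Span (map ι ∘ g) (ι ∘ v)
  ι-span g v (r , a , s , v≋) = r , ι ∘ a , s , λ i → trans (v≋ i) (ι-combination a (g ∘ s) i)

  ι-independent : (v : Vector (Vector K d) r) → LinearlyIndependent (map (map ι) v) →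
                  Kᶠ.LinearlyIndependent v
  ι-independent v indep a av≋0 =
    indep (ι ∘ a) λ i → trans (sym (ι-combination a v i)) (av≋0 i)

  ι-lrs : ∀ (c a : Vector K d) a′ → ι ∘ a ≋ a′ → ∀ n → ι (Kᶠ.lrs c a n) ≈ lrs (ι ∘ c) a′ n
  ι-lrs c a a′ a≋a′ = lrs-unique (ι ∘ c) a′ (ι ∘ Kᶠ.lrs c a)
    (λ n d≤n → trans (Kᶠ.lrs-satisfies c a n d≤n)
                      (ι-∙ c (λ i → Kᶠ.lrs c a (n ∸ suc (toℕ i)))))
    (λ i → trans (reflexive (cong ι (Kᶠ.lrs-initial c a i))) (a≋a′ i))

  characteristicRoot⇔ : ∀ (c e : Vector K d) → (∀ j → ι (c (opposite j)) ≈ ι (e j)) → ∀ z →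
    IsCharacteristicRoot c z ⇔ z ^ d ≈ sum (λ j → ι (e j) * z ^ toℕ j)
  characteristicRoot⇔ c e c≋e z = mk⇔
    (λ root → trans (GroupProperties.x∙y⁻¹≈ε⇒x≈y +-group _ _ root) descending)
    (λ root → GroupProperties.x≈y⇒x∙y⁻¹≈ε +-group (trans root (sym descending)))
    where descending = sum-ascending (ι ∘ c) (ι ∘ e) c≋e (z ^_) 0

  -- From an orbit problem to simultaneous zeros of sequences.

  module OrbitToSkolem (k≤d : k ≤ d) (I : OrbitInput d (d ∸ k)) where
    open OrbitInput I

    C : Kᶠ.Complement k basis
    C = Kᶠ.complement (ℕₚ.m∸n+n≡m k≤d) basis
    module C = Kᶠ.Complement C

    w : ℕ → Vector K d
    w = Kᵐ.orbit A x

    -- The given vectors are the `d` rows of the matrix with columns `w 0` to `w d`. A vector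
    -- orthogonal to all rows is a linear relation between the columns, and `d` equations in `suc d`
    -- unknowns leave one such vector.
    L : Kᶠ.Complement 1 (λ q (i : Fin (suc d)) → w (toℕ i) q)
    L = Kᶠ.complement (ℕₚ.+-comm d 1) _
    module L = Kᶠ.Complement L

    relation : Vector K (suc d)
    relation = L.ξ zero

    e : Vector K d
    e = Kᶠ.normalise relation

    output : SimSkolemInput d k
    output = record
      { coefficients = e ∘ opposite
      ; initial      = λ j i → w (toℕ i) ∙ₖ C.ξ j
      }
    open SimSkolemInput output using (u)

    module _ (reduced : Reduced A x) where

      -- Reducedness supplies `d` independent vectors in dimension `d`. Their complement is empty,
      -- so `spans` has no condition to check and every vector is in their span, which is that of
      -- the orbit from `m` on.
      w-spans : ∀ m v → Kᶠ.Span {I = ∃[ n ] m ≤ n} (w ∘ proj₁) v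
      w-spans m v with b , b-independent , span⇔ ← proj₂ reduced m =
        Equivalence.from (span⇔ v)
          (Kᶠ.Complement.spans (Kᶠ.complement (ℕₚ.+-identityʳ d) b) b-independent v λ ())

      W : ℕ → Vector Carrier d
      W n = ι ∘ w n

      W-suc : ∀ n → W (suc n) ≋ map (map ι) A *ᵥ W n
      W-suc n i = ι-∙ (A i) (w n)

      -- The unit vectors lie in the span of the orbit over `K`, and `ι` preserves this, so `f`
      -- pairs to zero with each of them. Reducedness over `K` thus controls functionals with
      -- algebraic coefficients.
      full : ∀ m f → (∀ n → m ≤ n → W n ∙ f ≈ 0#) → f ≋ 0ᵥ
      full m f W∙f≈0 i = begin
        f i                       ≈⟨ unit-∙ i f ⟨
        unit i ∙ f                ≈⟨ ∙-cong {v = f} (λ j → reflexive (ι-unit i j)) (λ _ → refl) ⟨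
        (ι ∘ Kᶠ.unit i) ∙ f
          ≈⟨ span-∙-zero (W ∘ proj₁) f (ι-span (w ∘ proj₁) (Kᶠ.unit i) (w-spans m (Kᶠ.unit i)))
               (λ (n , m≤n) → W∙f≈0 n m≤n) ⟩
        0#                        ∎

      full₀ : ∀ f → (∀ n → W n ∙ f ≈ 0#) → f ≋ 0ᵥ
      full₀ f W∙f≈0 = full 0 f (λ n _ → W∙f≈0 n)

      module WS = Sequence (map (map ι) A) W W-suc

      relation-w : Kᶠ.combination relation (w ∘ toℕ) Kᵐ.≋ Kᵐ.0ᵥ
      relation-w q = trans (Kᶠ.∙-comm relation (λ i → w (toℕ i) q)) (L.annihilates q zero)

      -- Otherwise `relation` would relate the first `d` orbit vectors, which are independent, and
      -- would be zero, although it pairs to one with its dual vector.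
      relation≉0 : ¬ (ι (last relation) ≈ 0#)
      relation≉0 last≈0 = 1≉0 (trans (sym (L.dual zero zero))
        (Kᶠ.∙-zeroʳ (L.η zero) relation
          (Kᶠ.vanishing-relation w relation last≈0
            (ι-independent _ (WS.initial-independent full₀ ℕₚ.≤-refl)) relation-w)))

      w-relation : w d Kᵐ.≋ Kᶠ.combination e (w ∘ toℕ)
      w-relation = Kᶠ.solve-relation w relation relation≉0 relation-w

      W-relation : W d ≋ combination (ι ∘ e) (W ∘ toℕ)
      W-relation i = trans (w-relation i) (ι-combination e (w ∘ toℕ) i)

      -- Pairing the shifted orbit relation with `C.ξ j` gives the recurrence, and the initial
      -- values agree by construction.
      u≈ : ∀ j n → ι (u j n) ≈ ι (w n ∙ₖ C.ξ j)
      u≈ j n = sym (Kᶠ.lrs-unique (e ∘ opposite) _ (λ n → w n ∙ₖ C.ξ j)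
        (Kᶠ.ascending⇒satisfies e {λ n → w n ∙ₖ C.ξ j}
          (Kᶠ.Sequence.relation-ascending A w (λ _ _ → refl) e w-relation (C.ξ j)))
        (λ _ → refl) n)

      root⇒eigenvalue : ∀ z → IsCharacteristicRoot (e ∘ opposite) z → IsEigenvalue A z
      root⇒eigenvalue z root = WS.root⇒eigenvector full₀ (ι ∘ e) W-relation z
        (Equivalence.to (characteristicRoot⇔ (e ∘ opposite) e
          (λ j → reflexive (cong (ι ∘ e) (opposite-involutive j))) z) root)

      promise : Problem.Promise (SimSkolem d k) output
      promise =
          -- The last coefficient of the recurrence is the constant one in ascending order. That it
          -- is non-zero comes from reducedness at `m` equal to 1.
          (λ i i≡ → constant-coefficient≉0 (map (map ι) A) W W-suc
             (λ f W∙f≈0 → full 1 f λ { (suc n) _ → W∙f≈0 n }) (ι ∘ e) W-relation (opposite i)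
             (≡.trans (opposite-prop i) (≡.trans (cong (d ∸_) i≡) (ℕₚ.n∸n≡0 d))))
        , (λ z w rz rw → proj₁ reduced z w (root⇒eigenvalue z rz) (root⇒eigenvalue w rw))
        -- A vanishing combination of the sequences is a combination of the `C.ξ j` that kills the
        -- whole orbit, hence zero. Duality, carried over by `ι`, gives independence of the `C.ξ j`
        -- over the algebraic numbers.
        , λ a au≈0 → dual⇒independent (map (map ι) C.η) (map (map ι) C.ξ)
            (λ i l → trans (sym (ι-∙ (C.η i) (C.ξ l)))
                           (trans (C.dual i l) (reflexive (ι-unit i l)))) a
            (full₀ _ λ n → begin
              W n ∙ combination a (map (map ι) C.ξ)
                ≈⟨ ∙-combination (W n) a (map (map ι) C.ξ) ⟩
              sum (λ j → a j * W n ∙ (ι ∘ C.ξ j))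
                ≈⟨ ∙-cong {u = a} (λ _ → refl) (λ j → trans (u≈ j n) (ι-∙ (w n) (C.ξ j))) ⟨
              sum (λ j → a j * ι (u j n))
                ≈⟨ au≈0 n ⟩
              0# ∎)

    correct : Problem.Promise (Orbit d (d ∸ k)) I →
              Problem.Yes (Orbit d (d ∸ k)) I ⇔ Problem.Yes (SimSkolem d k) output
    correct (reduced , independent) = mk⇔
      (λ (n , w∈S) → n , λ j → trans (u≈ reduced j n)
        (Kᶠ.span-∙-zero basis (C.ξ j) w∈S (λ i → C.annihilates i j)))
      (λ (n , u≈0) → n , C.spans independent (w n) λ j → trans (sym (u≈ reduced j n)) (u≈0 j))

  orbit≤skolem : k ≤ d → Orbit d (d ∸ k) ≤ₘ SimSkolem d k
  orbit≤skolem k≤d = record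
    { reduce    = λ I → OrbitToSkolem.output k≤d I
    ; preserves = λ I (reduced , _) → OrbitToSkolem.promise k≤d I reduced
    ; correct   = λ I → OrbitToSkolem.correct k≤d I
    }

  -- From simultaneous zeros of sequences to an orbit problem.

  module SkolemToOrbit (k≤d : k ≤ d) (I : SimSkolemInput d k) where
    open SimSkolemInput I
    open Kᶠ.Companion coefficients using (companion; fundamental-suc)

    C : Kᶠ.Complement (d ∸ k) initial
    C = Kᶠ.complement (ℕₚ.m+[n∸m]≡n k≤d) initial
    module C = Kᶠ.Complement C

    w : ℕ → Vector K d
    w = Kᶠ.fundamental coefficients

    output : OrbitInput d (d ∸ k)
    -- The start vector `w 0` represents the polynomial 1; unlike `unit zero` it is also meaningful
    -- for `d` equal to 0.
    output = record { A = companion ; x = w 0 ; basis = C.ξ }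

    orbit≋w : ∀ n → Kᵐ.orbit companion (w 0) n Kᵐ.≋ w n
    orbit≋w zero    i = refl
    orbit≋w (suc n) i =
      trans (Kᶠ.*ᵥ-cong companion (orbit≋w n) i) (sym (fundamental-suc n i))

    u≈ : ∀ j n → ι (u j n) ≈ ι (initial j ∙ₖ Kᵐ.orbit companion (w 0) n)
    u≈ j n = trans (Kᶠ.expand-lrs coefficients (initial j) n) (trans (Kᶠ.∙-comm (w n) (initial j))
      (Kᶠ.∙-cong {u = initial j} (λ _ → refl) (λ i → sym (orbit≋w n i))))

    -- Each sequence is the pairing of its initial vector with the orbit, so a relation between the
    -- initial vectors is one between the sequences.
    initial-independent : LinearlyIndependentSequences u → Kᶠ.LinearlyIndependent initial
    initial-independent independent b ba≋0 = independent (ι ∘ b) λ n → begin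
      sum (λ j → ι (b j) * ι (u j n))
        ≈⟨ ι-∙ b (λ j → u j n) ⟨
      ι (b ∙ₖ λ j → u j n)
        ≈⟨ Kᶠ.∙-cong {u = b} (λ _ → refl) (λ j → u≈ j n) ⟩
      ι (b ∙ₖ λ j → initial j ∙ₖ Kᵐ.orbit companion (w 0) n)
        ≈⟨ Kᶠ.combination-∙ b initial _ ⟨
      ι (Kᶠ.combination b initial ∙ₖ Kᵐ.orbit companion (w 0) n)
        ≈⟨ Kᶠ.∙-zeroˡ _ _ ba≋0 ⟩
      0# ∎

    eigenvalue⇒root : ∀ z → IsEigenvalue companion z → IsCharacteristicRoot coefficients z
    eigenvalue⇒root z (v , v≉0 , Av≋zv) =
      Equivalence.from (characteristicRoot⇔ coefficients (coefficients ∘ opposite) (λ _ → refl) z)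
        -- The lemma is applied to the companion matrix built over the algebraic numbers, which
        -- agrees entrywise with the image of the one over `K`.
        (Companion.eigenvalue⇒root (ι ∘ coefficients) z v v≉0 λ q → trans
          (∙-cong {v = v} (λ j → sym (ι-lrs coefficients (Kᶠ.unit q) (unit q)
            (λ i → reflexive (ι-unit q i)) (suc (toℕ j)))) (λ _ → refl))
          (Av≋zv q))

    promise : Problem.Promise (SimSkolem d k) I →
              Problem.Promise (Orbit d (d ∸ k)) output
    promise (c≉0 , nondegenerate , _) =
      ( (λ z w ez ew → nondegenerate z w (eigenvalue⇒root z ez) (eigenvalue⇒root w ew))
      , dimension
      ) , C.ξ-independent
      where
      dimension : ∀ m → Kᵐ.HasDimension
        (Kᵐ.Span {I = ∃[ n ] m ≤ n} (λ (n , _) → Kᵐ.orbit companion (w 0) n)) d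
      dimension m = b , b-independent , λ v → mk⇔
        (λ _ → Kᶠ.Complement.spans (Kᶠ.complement (ℕₚ.+-identityʳ d) b) b-independent v λ ())
        (λ (r , α , s , v≋) → r , α , (λ l → m ℕ.+ toℕ (s l) , ℕₚ.m≤m+n m _) , v≋)
        where
        b : Vector (Vector K d) d
        -- Any `d` consecutive orbit vectors are independent because the last recurrence coefficient
        -- is non-zero, so they form a basis of the whole space.
        b j = Kᵐ.orbit companion (w 0) (m ℕ.+ toℕ j)

        b-independent : Kᶠ.LinearlyIndependent b
        b-independent α αb≋0 = Kᶠ.fundamental-independent coefficients c≉0 m α λ q → trans
          (Kᶠ.combination-cong {a = α} {v = λ j → w (m ℕ.+ toℕ j)} {w = b}
            (λ _ → refl) (λ j i → sym (orbit≋w (m ℕ.+ toℕ j) i)) q)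
          (αb≋0 q)

    correct : Problem.Promise (SimSkolem d k) I →
              Problem.Yes (SimSkolem d k) I ⇔ Problem.Yes (Orbit d (d ∸ k)) output
    correct (_ , _ , independent) = mk⇔
      -- A common zero makes the orbit vector orthogonal to every initial vector, and `exhausts`
      -- then writes it as a combination of the basis `C.ξ`.
      (λ (n , u≈0) → n , _ , _ , id ,
        C.exhausts (initial-independent independent) (Kᵐ.orbit companion (w 0) n)
          (λ j → trans (sym (u≈ j n)) (u≈0 j)))
      (λ (n , w∈S) → n , λ j → trans (u≈ j n)
        (trans (Kᶠ.∙-comm (initial j) (Kᵐ.orbit companion (w 0) n))
          (Kᶠ.span-∙-zero C.ξ (initial j) w∈S λ l →
            trans (Kᶠ.∙-comm (C.ξ l) (initial j)) (C.annihilates j l))))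

  skolem≤orbit : k ≤ d → SimSkolem d k ≤ₘ Orbit d (d ∸ k)
  skolem≤orbit k≤d = record
    { reduce    = λ I → SkolemToOrbit.output k≤d I
    ; preserves = λ I → SkolemToOrbit.promise k≤d I
    ; correct   = λ I → SkolemToOrbit.correct k≤d I
    }

proposition8 : ∀ {c ℓ p : Level} (ℚ̄ : AlgebraicNumbers c ℓ)
    (𝕂 : Subfield (AlgebraicNumbers.discreteField ℚ̄) p)
    (d k : ℕ) → k ≤ d →
    (Problems.Orbit ℚ̄ 𝕂 d (d ∸ k) ≤ₘ Problems.SimSkolem ℚ̄ 𝕂 d k) ×
    (Problems.SimSkolem ℚ̄ 𝕂 d k ≤ₘ Problems.Orbit ℚ̄ 𝕂 d (d ∸ k))
proposition8 ℚ̄ 𝕂 d k k≤d = orbit≤skolem k≤d , skolem≤orbit k≤d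
  where open Reductions ℚ̄ 𝕂
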